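{- Let $n$ and $k$ be integers with $3\le k\le n$. The number $f_k(n)$ of $k$-in-$n$ dissections is $$f_k(n)=\binom{2n-k-1}{n-1}.$$
   Context: Fix a convex $n$-gon ($n\ge 3$) with labelled (distinguishable) vertices; dissections are counted as distinct when their sets of diagonals differ (no identification under rotation or reflection). For $0\le m\le n-3$, an $m$-dissection of the $n$-gon is a partition of the $n$-gon into $m+1$ parts by $m$ pairwise noncrossing diagonals. A triangulation of the $n$-gon is an $(n-3)$-dissection; it has $n-2$ triangles. For $4\le k\le n$, a $k$-in-$n$ dissection is an $(n-k)$-dissection of the $n$-gon whose parts are one $k$-gon and $n-k$ triangles; when $k=4$ the one $4$-gon is the unique non-triangular part, and when $k=n$ there are no diagonals. A $3$-in-$n$ dissection is a triangulation of the $n$-gon together with a choice of one of its $n-2$ triangles (the marked triangle). $f_k(n)$ denotes the number of $k$-in-$n$ dissections. -}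

module Defs where

open import Data.Nat.Base as ℕ using (ℕ; suc; _∸_)
open import Data.Fin.Base using (Fin; toℕ; _<_; _≤_)
open import Data.Fin.Subset as Subset using (Subset; ∣_∣)
open import Data.List.Base using (List; _∷_; length)
open import Data.List.Membership.Propositional using (_∈_)
open import Data.List.Relation.Binary.BagAndSetEquality using ([_]-Equality; set)
open import Data.List.Relation.Unary.All using (All)
open import Data.List.Relation.Unary.Unique.Propositional using (Unique)
open import Data.Product.Base using (Σ-syntax; _×_; _,_; proj₁)
open import Data.Product.Relation.Binary.Pointwise.NonDependent using (×-setoid)
open import Data.Sum.Base using (_⊎_)
open import Function.Bundles using (Inverse; _⇔_)
open import Level using (0ℓ)
open import Relation.Binary.Bundles using (Setoid)
import Relation.Binary.Construct.On as On
open import Relation.Binary.PropositionalEquality using (_≡_; setoid)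
open import Relation.Nullary.Negation.Core using (¬_)

private
  variable
    n : ℕ

-- The vertices of the n-gon are the elements of Fin n, in cyclic order.  A
-- segment between two distinct vertices is represented by the pair of its
-- endpoints, the smaller one first.

Segment : ℕ → Set
Segment n = Fin n × Fin n

IsSide : Segment n → Set
IsSide {n} (i , j) =
  (toℕ j ≡ suc (toℕ i)) ⊎ (toℕ i ≡ 0 × suc (toℕ j) ≡ n)

IsDiagonal : Segment n → Set
IsDiagonal (i , j) = i < j × ¬ IsSide (i , j)

-- By convexity, two diagonals meet in their interiors exactly when their
-- endpoints alternate around the polygon.

Crossing : Segment n → Segment n → Set
Crossing (i , j) (k , l) =
  (i < k × k < j × j < l) ⊎ (k < i × i < l × l < j)

-- A finite set of diagonals is a duplicate-free list, considered up to
-- equality of its set of members (see the setoids below).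

record IsDissection (m : ℕ) (D : List (Segment n)) : Set where
  field
    diagonals   : All IsDiagonal D
    unique      : Unique D
    size        : length D ≡ m
    noncrossing : ∀ {d e} → d ∈ D → e ∈ D → ¬ Crossing d e

-- For i < j in S, the segment (i , j) is a side of the convex hull of S exactly
-- when S has no vertex strictly between i and j, or none outside that range.

Consecutive : Subset n → Segment n → Set
Consecutive S (i , j) =
  (∀ l → l Subset.∈ S → ¬ (i < l × l < j)) ⊎
  (∀ l → l Subset.∈ S → i ≤ l × l ≤ j)

-- A part is identified with its set of vertices.  The convex hull of S is a part
-- of the dissection when each of its sides is a side of the n-gon or a diagonal
-- in D, while none of its own diagonals is in D.  (A segment that is not a side
-- of the hull of S cannot be a side of the n-gon.)

record IsPart (D : List (Segment n)) (S : Subset n) : Set where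
  field
    polygon : 3 ℕ.≤ ∣ S ∣
    edges   : ∀ i j → i Subset.∈ S → j Subset.∈ S → i < j →
              Consecutive S (i , j) ⇔ (IsSide (i , j) ⊎ (i , j) ∈ D)

IsTriangle : Subset n → Set
IsTriangle S = ∣ S ∣ ≡ 3

-- The parts of D are one k-gon and n ∸ k triangles.

record PartsAreOneGonAndTriangles (k : ℕ) (D : List (Segment n)) : Set where
  field
    gon            : Subset n
    triangles      : List (Subset n)
    gon-size       : ∣ gon ∣ ≡ k
    triangles-size : All IsTriangle triangles
    triangles-num  : length triangles ≡ n ∸ k
    distinct       : Unique (gon ∷ triangles)
    parts          : ∀ S → IsPart D S ⇔ S ∈ gon ∷ triangles

UnmarkedDissection : ℕ → ℕ → Set
UnmarkedDissection n k =
  Σ[ D ∈ List (Segment n) ]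
    IsDissection (n ∸ k) D × PartsAreOneGonAndTriangles k D

MarkedTriangulation : ℕ → Set
MarkedTriangulation n =
  Σ[ (D , T) ∈ List (Segment n) × Subset n ]
    IsDissection (n ∸ 3) D × IsPart D T × IsTriangle T

-- The k-in-n dissections, for 3 ≤ k ≤ n (the values at k < 3 are irrelevant).
-- For k = 3 two of them are equal when they have the same diagonals and the same
-- marked triangle; otherwise, when they have the same diagonals.

KInN : ℕ → ℕ → Setoid 0ℓ 0ℓ
KInN n 3 =
  On.setoid {B = MarkedTriangulation n}
    (×-setoid ([ set ]-Equality (Segment n)) (setoid (Subset n))) proj₁
KInN n k =
  On.setoid {B = UnmarkedDissection n k} ([ set ]-Equality (Segment n)) proj₁

HasCardinality : Setoid 0ℓ 0ℓ → ℕ → Set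
HasCardinality S N = Inverse S (setoid (Fin N))

-- Seen from the side (0 , n − 1), a k-in-n dissection is a binary tree with n − 1
-- leaves in which one node, the k-gon, carries k − 1 subtrees: a path of triangles
-- leads from that side to the k-gon, each with a tree on its other side, and
-- binary trees hang from the remaining k − 1 sides of the k-gon.  Let F(r , l) be
-- the number of such configurations with r trees below the k-gon and l leaves in
-- all.  If the first of the r trees is a leaf, deleting it leaves r − 1 trees and
-- l − 1 leaves; otherwise its root can be dropped, which leaves r + 1 trees.  For
-- r = 0 the first triangle of the path, whose tree is on the left or on the right, is
-- removed and this tree becomes the only one:
--
--   F(r , l) = F(r − 1 , l − 1) + F(r + 1 , l),   F(0 , l) = 2 F(1 , l),
--
-- and F(r , l) = C(2l − r , l) by Pascal's rule.  That the trees account for all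
-- dissections rests on the fact that a part is determined by its smallest and its
-- largest vertex, which are joined by an edge.  For k = 3 one also needs that
-- n − 3 noncrossing diagonals leave only triangles.

module Submission where

open import Defs
open import Data.Empty using (⊥; ⊥-elim)
open import Data.Fin.Base using (Fin; zero; suc; toℕ; fromℕ; fromℕ<; _<_; _≤_; _>_)
open import Data.Fin.Induction using (<-wellFounded; >-wellFounded)
import Data.Fin.Properties as Fin
open import Data.Fin.Subset as Subset using (Subset; inside; outside; ∣_∣; ⁅_⁆; _∪_)
import Data.Fin.Subset.Properties as Subset
open import Data.List.Base using (List; []; _∷_; _++_; length; map; filter; foldr)
open import Data.List.Membership.Propositional using (_∈_; _∉_; lose)
import Data.List.Membership.DecPropositional as DecMembership
open import Data.List.Membership.Propositional.Properties
  using (∈-++⁺ˡ; ∈-++⁺ʳ; ∈-++⁻; ∈-filter⁺; ∈-filter⁻; ∈-map⁺; ∈-map⁻)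
import Data.List.Properties as List
open import Data.List.Relation.Binary.BagAndSetEquality using (_∼[_]_; set)
open import Data.List.Relation.Unary.All as All using (All; []; _∷_)
import Data.List.Relation.Unary.All.Properties as All
open import Data.List.Relation.Unary.AllPairs using ([]; _∷_)
open import Data.List.Relation.Unary.Any using (here; there; any?)
open import Data.List.Relation.Unary.Unique.Propositional using (Unique)
import Data.List.Relation.Unary.Unique.Propositional.Properties as Unique
open import Data.Nat.Base as ℕ using (ℕ; zero; suc; z≤n; s≤s; _+_; _*_; _∸_)
open import Data.Nat.Combinatorics using (_C_; nCk≡nC[n∸k]; k>n⇒nCk≡0; nCk+nC[k+1]≡[n+1]C[k+1])
import Data.Nat.Induction as ℕ
import Data.Nat.Properties as ℕ
open import Data.Nat.Tactic.RingSolver using (solve-∀)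
open import Data.Product.Base using (Σ-syntax; ∃-syntax; _×_; _,_; proj₁; proj₂; uncurry)
open import Data.Product.Properties using (≡-dec)
open import Data.Sum.Base using (_⊎_; inj₁; inj₂)
open import Data.Sum.Function.Propositional using (_⊎-↔_)
open import Data.Vec.Base using (Vec; []; _∷_; here; there; tabulate)
open import Data.Vec.Properties using (lookup∘tabulate; []=⇒lookup; lookup⇒[]=)
open import Function.Base using (_∘_)
open import Function.Bundles using (_⇔_; mk⇔; Equivalence; Inverse; _↔_; mk↔ₛ′)
open import Function.Properties.Inverse using (↔-sym; ↔-trans)
open import Induction.WellFounded using (Acc; acc)
open import Relation.Binary.Bundles using (Setoid)
open import Relation.Binary.Definitions using (DecidableEquality; tri<; tri≈; tri>)
open import Relation.Binary.PropositionalEquality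
open import Relation.Nullary using (¬_; Dec; yes; no; does; contradiction)
open import Relation.Nullary.Decidable using (¬?; _×-dec_; _⊎-dec_; _→-dec_; dec-true)
open import Relation.Unary using (Decidable)

private
  variable
    n r : ℕ

-- Duplicate-free lists and the pigeonhole principle

module _ {A : Set} (_≟_ : DecidableEquality A) where

  abstract

    remove : A → List A → List A
    remove x = filter (¬? ∘ (x ≟_))

    ∈-remove⁺ : ∀ {x y xs} → y ∈ xs → x ≢ y → y ∈ remove x xs
    ∈-remove⁺ = ∈-filter⁺ _

    ∈-remove⁻ : ∀ {x y} xs → y ∈ remove x xs → y ∈ xs × x ≢ y
    ∈-remove⁻ xs = ∈-filter⁻ _ {xs = xs}

    remove-unique : ∀ {x xs} → Unique xs → Unique (remove x xs)
    remove-unique = Unique.filter⁺ _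

    remove-< : ∀ {x xs} → x ∈ xs → length (remove x xs) ℕ.< length xs
    remove-< x∈ = List.filter-notAll _ _ (lose x∈ (λ ¬p → ¬p refl))

  length-mono : ∀ {xs ys} → Unique xs → (∀ {x} → x ∈ xs → x ∈ ys) → length xs ℕ.≤ length ys
  length-mono {[]}     _        _   = z≤n
  length-mono {x ∷ xs} (x∉ ∷ u) sub = ℕ.≤-trans
    (s≤s (length-mono u λ z∈ → ∈-remove⁺ (sub (there z∈)) (All.lookup x∉ z∈)))
    (remove-< (sub (here refl)))

  length-remove : ∀ {x xs} → Unique xs → x ∈ xs → suc (length (remove x xs)) ≡ length xs
  length-remove {x} {xs} u x∈ = ℕ.≤-antisym (remove-< x∈) (length-mono u sub)
    where
    sub : ∀ {z} → z ∈ xs → z ∈ x ∷ remove x xs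
    sub {z} z∈ with x ≟ z
    ... | yes x≡z = here (sym x≡z)
    ... | no  x≢z = there (∈-remove⁺ z∈ x≢z)

  -- Pigeonhole: a `y` missing from `xs` could be put in front of it, giving a duplicate-free list
  -- inside `ys` that is longer than `ys`.
  ⊆⇒⊇ : ∀ {xs ys} → Unique xs → (∀ {x} → x ∈ xs → x ∈ ys) → length ys ℕ.≤ length xs →
        ∀ {y} → y ∈ ys → y ∈ xs
  ⊆⇒⊇ {xs} {ys} u sub ≤ {y} y∈ with any? (y ≟_) xs
  ... | yes y∈xs = y∈xs
  ... | no  y∉xs = contradiction (ℕ.≤-trans (length-mono (fresh ∷ u) sub′) ≤) (ℕ.<-irrefl refl)
    where
    fresh : All (y ≢_) xs
    fresh = All.tabulate λ { z∈ refl → y∉xs z∈ }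
    sub′ : ∀ {x} → x ∈ y ∷ xs → x ∈ ys
    sub′ (here refl) = y∈
    sub′ (there x∈)  = sub x∈

-- Sizes of vertex sets

fromList : List (Fin n) → Subset n
fromList = foldr (λ x p → ⁅ x ⁆ ∪ p) Subset.⊥

∈-fromList⁺ : ∀ {x : Fin n} {xs} → x ∈ xs → x Subset.∈ fromList xs
∈-fromList⁺ (here refl) = Subset.x∈p∪q⁺ (inj₁ (Subset.x∈⁅x⁆ _))
∈-fromList⁺ (there x∈)  = Subset.x∈p∪q⁺ (inj₂ (∈-fromList⁺ x∈))

∈-fromList⁻ : ∀ {x : Fin n} xs → x Subset.∈ fromList xs → x ∈ xs
∈-fromList⁻ []       x∈ = ⊥-elim (Subset.∉⊥ x∈)
∈-fromList⁻ (y ∷ xs) x∈ with Subset.x∈p∪q⁻ ⁅ y ⁆ (fromList xs) x∈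
... | inj₁ x∈y = here (Subset.x∈⁅y⁆⇒x≡y _ x∈y)
... | inj₂ x∈p = there (∈-fromList⁻ xs x∈p)

∣⁅x⁆∪p∣ : ∀ (x : Fin n) p → x Subset.∉ p → ∣ ⁅ x ⁆ ∪ p ∣ ≡ suc ∣ p ∣
∣⁅x⁆∪p∣ zero    (outside ∷ p) _  = cong (suc ∘ ∣_∣) (Subset.∪-identityˡ p)
∣⁅x⁆∪p∣ zero    (inside  ∷ p) x∉ = contradiction here x∉
∣⁅x⁆∪p∣ (suc x) (outside ∷ p) x∉ = ∣⁅x⁆∪p∣ x p (x∉ ∘ there)
∣⁅x⁆∪p∣ (suc x) (inside  ∷ p) x∉ = cong suc (∣⁅x⁆∪p∣ x p (x∉ ∘ there))

∣fromList∣ : ∀ {xs : List (Fin n)} → Unique xs → ∣ fromList xs ∣ ≡ length xs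
∣fromList∣ {n} {[]}     _        = Subset.∣⊥∣≡0 n
∣fromList∣ {n} {x ∷ xs} (x∉ ∷ u) =
  trans (∣⁅x⁆∪p∣ x _ λ x∈ → All.lookup x∉ (∈-fromList⁻ xs x∈) refl) (cong suc (∣fromList∣ u))

unique⇒length≤∣p∣ : ∀ {xs : List (Fin n)} {p} → Unique xs → (∀ {x} → x ∈ xs → x Subset.∈ p) →
                    length xs ℕ.≤ ∣ p ∣
unique⇒length≤∣p∣ {xs = xs} u sub =
  subst (ℕ._≤ _) (∣fromList∣ u) (Subset.p⊆q⇒∣p∣≤∣q∣ (sub ∘ ∈-fromList⁻ xs))

covered⇒∣p∣≤length : ∀ (xs : List (Fin n)) {p} → (∀ {x} → x Subset.∈ p → x ∈ xs) →
                     ∣ p ∣ ℕ.≤ length xs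
covered⇒∣p∣≤length {n} xs sub =
  ℕ.≤-trans (Subset.p⊆q⇒∣p∣≤∣q∣ {q = fromList xs} (∈-fromList⁺ ∘ sub)) (∣fromList∣≤ xs)
  where
  ∣fromList∣≤ : ∀ ys → ∣ fromList ys ∣ ℕ.≤ length ys
  ∣fromList∣≤ []       = ℕ.≤-reflexive (Subset.∣⊥∣≡0 n)
  ∣fromList∣≤ (y ∷ ys) with y Subset.∈? fromList ys
  ... | yes y∈ = ℕ.≤-trans
    (Subset.p⊆q⇒∣p∣≤∣q∣ {q = fromList ys} λ z∈ → absorb (Subset.x∈p∪q⁻ ⁅ y ⁆ (fromList ys) z∈))
    (ℕ.m≤n⇒m≤1+n (∣fromList∣≤ ys))
    where
    absorb : ∀ {z} → z Subset.∈ ⁅ y ⁆ ⊎ z Subset.∈ fromList ys → z Subset.∈ fromList ys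
    absorb (inj₁ z∈) rewrite Subset.x∈⁅y⁆⇒x≡y _ z∈ = y∈
    absorb (inj₂ z∈) = z∈
  ... | no  y∉ = ℕ.≤-trans (ℕ.≤-reflexive (∣⁅x⁆∪p∣ y _ y∉)) (s≤s (∣fromList∣≤ ys))

-- Decidable vertex sets and their extreme elements

module _ {P : Fin n → Set} (P? : Decidable P) where

  comprehension : Subset n
  comprehension = tabulate (does ∘ P?)

  ∈-comprehension⁺ : ∀ {x} → P x → x Subset.∈ comprehension
  ∈-comprehension⁺ {x} px =
    lookup⇒[]= x _ (trans (lookup∘tabulate (does ∘ P?) x) (dec-true (P? x) px))

  ∈-comprehension⁻ : ∀ {x} → x Subset.∈ comprehension → P x
  ∈-comprehension⁻ {x} x∈ with P? x | trans (sym (lookup∘tabulate (does ∘ P?) x)) ([]=⇒lookup x∈)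
  ... | yes px | _ = px

  -- Climbs from the witness `x` to larger ones until none is left. The bound `x ≤ q` is returned as
  -- well, since the result is later compared with the vertex from which the search began.
  greatest : ∀ {x} → P x → ∃[ q ] x ≤ q × P q × (∀ {l} → P l → l ≤ q)
  greatest {x} = go (>-wellFounded x)
    where
    go : ∀ {x} → Acc _>_ x → P x → ∃[ q ] x ≤ q × P q × (∀ {l} → P l → l ≤ q)
    go {x} (acc rs) px with Fin.any? (λ l → (x Fin.<? l) ×-dec P? l)
    ... | no  none = x , ℕ.≤-refl , px , λ pl → ℕ.≮⇒≥ λ x<l → none (_ , x<l , pl)
    ... | yes (l , x<l , pl) =
      let q , l≤q , rest = go (rs x<l) pl in q , ℕ.≤-trans (ℕ.<⇒≤ x<l) l≤q , rest

  least : ∀ {x} → P x → ∃[ q ] q ≤ x × P q × (∀ {l} → P l → q ≤ l)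
  least {x} = go (<-wellFounded x)
    where
    go : ∀ {x} → Acc _<_ x → P x → ∃[ q ] q ≤ x × P q × (∀ {l} → P l → q ≤ l)
    go {x} (acc rs) px with Fin.any? (λ l → (l Fin.<? x) ×-dec P? l)
    ... | no  none = x , ℕ.≤-refl , px , λ pl → ℕ.≮⇒≥ λ l<x → none (_ , l<x , pl)
    ... | yes (l , l<x , pl) =
      let q , q≤l , rest = go (rs l<x) pl in q , ℕ.≤-trans q≤l (ℕ.<⇒≤ l<x) , rest

-- Edges: sides and diagonals together

_≟ˢ_ : DecidableEquality (Segment n)
_≟ˢ_ = ≡-dec Fin._≟_ Fin._≟_

Edge : List (Segment n) → Fin n → Fin n → Set
Edge D i j = IsSide (i , j) ⊎ (i , j) ∈ D

edge? : ∀ (D : List (Segment n)) i j → Dec (Edge D i j)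
edge? {n} D i j =
  ((toℕ j ℕ.≟ suc (toℕ i)) ⊎-dec ((toℕ i ℕ.≟ 0) ×-dec (suc (toℕ j) ℕ.≟ n)))
  ⊎-dec (DecMembership._∈?_ _≟ˢ_ (i , j) D)

record Laminar (D : List (Segment n)) : Set where
  field
    ascending : ∀ {i j} → Edge D i j → i < j
    crossless : ∀ {i j k l} → Edge D i j → Edge D k l → i < k → k < j → j < l → ⊥

-- Only two diagonals could cross: no vertex lies strictly inside a side (i , i + 1), and none lies
-- outside the range of the side (0 , n - 1). The bound on `n` excludes the degenerate side (0 , 0)
-- of a 1-gon.
laminar : ∀ {D : List (Segment n)} → 2 ℕ.≤ n → All IsDiagonal D →
          (∀ {d e} → d ∈ D → e ∈ D → ¬ Crossing d e) → Laminar D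
laminar {n} {D} 2≤n diag nc = record { ascending = asc ; crossless = cross }
  where
  asc : ∀ {i j} → Edge D i j → i < j
  asc (inj₁ (inj₁ j≡1+i)) = ℕ.≤-reflexive (sym j≡1+i)
  asc (inj₁ (inj₂ (i≡0 , 1+j≡n))) =
    subst (ℕ._< _) (sym i≡0) (ℕ.s<s⁻¹ (subst (2 ℕ.≤_) (sym 1+j≡n) 2≤n))
  asc (inj₂ ij∈) = proj₁ (All.lookup diag ij∈)

  cross : ∀ {i j k l} → Edge D i j → Edge D k l → i < k → k < j → j < l → ⊥
  cross (inj₁ (inj₁ j≡1+i)) _ i<k k<j _ =
    ℕ.<⇒≱ k<j (subst (ℕ._≤ _) (sym j≡1+i) i<k)
  cross {l = l} (inj₁ (inj₂ (_ , 1+j≡n))) _ _ _ j<l =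
    ℕ.<⇒≱ (Fin.toℕ<n l) (subst (ℕ._≤ toℕ l) 1+j≡n j<l)
  cross (inj₂ _) (inj₁ (inj₁ l≡1+k)) _ k<j j<l =
    ℕ.<⇒≱ j<l (subst (ℕ._≤ _) (sym l≡1+k) k<j)
  cross (inj₂ _) (inj₁ (inj₂ (k≡0 , _))) i<k _ _ = ℕ.n≮0 (subst (_ ℕ.<_) k≡0 i<k)
  cross (inj₂ ij∈) (inj₂ kl∈) i<k k<j j<l = nc ij∈ kl∈ (inj₁ (i<k , k<j , j<l))

-- Faces of a noncrossing set of diagonals

-- A part is determined by its extreme vertices a and b: its other vertices are
-- those that no further edge below (a , b) cuts off from (a , b).

Visible : List (Segment n) → Fin n → Fin n → Fin n → Set
Visible D a b v =
  a ≤ v × v ≤ b ×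
  (∀ x y → Edge D x y → a ≤ x → x < v → v < y → y ≤ b → x ≡ a × y ≡ b)

visible? : ∀ (D : List (Segment n)) a b → Decidable (Visible D a b)
visible? D a b v =
  (a Fin.≤? v) ×-dec (v Fin.≤? b) ×-dec
  Fin.all? λ x → Fin.all? λ y → edge? D x y →-dec ((a Fin.≤? x) →-dec ((x Fin.<? v) →-dec
    ((v Fin.<? y) →-dec ((y Fin.≤? b) →-dec ((x Fin.≟ a) ×-dec (y Fin.≟ b))))))

face : List (Segment n) → Segment n → Subset n
face D (a , b) = comprehension (visible? D a b)

record Ends (S : Subset n) (a b : Fin n) : Set where
  field
    left∈  : a Subset.∈ S
    right∈ : b Subset.∈ S
    bounds : ∀ {l} → l Subset.∈ S → a ≤ l × l ≤ b

ends-unique : ∀ {S : Subset n} {a b c d} → Ends S a b → Ends S c d → a ≡ c × b ≡ d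
ends-unique E F =
  Fin.≤-antisym (proj₁ (bounds E (left∈ F))) (proj₁ (bounds F (left∈ E))) ,
  Fin.≤-antisym (proj₂ (bounds F (right∈ E))) (proj₂ (bounds E (right∈ F)))
  where open Ends

≢∧≤⇒< : ∀ {i j : Fin n} → i ≢ j → i ≤ j → i < j
≢∧≤⇒< i≢j i≤j = ℕ.≤∧≢⇒< i≤j (i≢j ∘ Fin.toℕ-injective)

-- Singles out the edges that have a face below them: the sides (i , i + 1) drop out, while the side
-- (0 , n - 1) of an n-gon with n ≥ 3 stays and stands for the outermost face.
Wide : Segment n → Set
Wide (i , j) = suc (toℕ i) ℕ.< toℕ j

Apex : List (Segment n) → Fin n → Fin n → Fin n → Set
Apex D a b m = a < m × m < b × Edge D a m × Edge D m b

module Faces {D : List (Segment n)} (L : Laminar D) where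

  open Laminar L
  open Ends

  visible-left : ∀ {a b} → a ≤ b → Visible D a b a
  visible-left a≤b = ℕ.≤-refl , a≤b , λ _ _ _ a≤x x<a _ _ → contradiction x<a (ℕ.≤⇒≯ a≤x)

  visible-right : ∀ {a b} → a ≤ b → Visible D a b b
  visible-right a≤b = a≤b , ℕ.≤-refl , λ _ _ _ _ _ b<y y≤b → contradiction b<y (ℕ.≤⇒≯ y≤b)

  face-ends : ∀ {a b} → a ≤ b → Ends (face D (a , b)) a b
  face-ends {a} {b} a≤b = record
    { left∈  = ∈-comprehension⁺ (visible? D a b) (visible-left a≤b)
    ; right∈ = ∈-comprehension⁺ (visible? D a b) (visible-right a≤b)
    ; bounds = λ l∈ → let a≤l , l≤b , _ = ∈-comprehension⁻ (visible? D a b) l∈ in a≤l , l≤b }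

  face-injective : ∀ {d e} → proj₁ d < proj₂ d → proj₁ e < proj₂ e → face D d ≡ face D e → d ≡ e
  face-injective {a , b} {x , y} a<b x<y eq =
    let a≡x , b≡y = ends-unique (face-ends (ℕ.<⇒≤ a<b))
                      (subst (λ S → Ends S x y) (sym eq) (face-ends (ℕ.<⇒≤ x<y)))
    in cong₂ _,_ a≡x b≡y

  successor : ∀ {a b : Fin n} → a < b → ∃[ s ] toℕ s ≡ suc (toℕ a)
  successor {a} {b} a<b = fromℕ< 1+a<n , Fin.toℕ-fromℕ< 1+a<n
    where
    1+a<n : suc (toℕ a) ℕ.< n
    1+a<n = ℕ.≤-<-trans a<b (Fin.toℕ<n b)

  -- `m` is the far end of the longest edge from `a` that stops short of `b`; the side (a , a + 1)
  -- shows that there is one. An edge hiding `m` would cross `(a , m)` if it started after `a`, and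
  -- would be a longer candidate if it started at `a` and ended before `b`.
  interior : ∀ {a b} → Wide (a , b) → ∃[ m ] a < m × m < b × Visible D a b m
  interior {a} {b} wide
    with s , s≡1+a ← successor {a} {b} (ℕ.<⇒≤ wide)
    with m , _ , (am , m<b) , max ← greatest {P = λ l → Edge D a l × l < b}
           (λ l → edge? D a l ×-dec (l Fin.<? b))
           {s} (inj₁ (inj₁ s≡1+a) , subst (ℕ._< toℕ b) (sym s≡1+a) wide)
    = m , ascending am , m<b , ℕ.<⇒≤ (ascending am) , ℕ.<⇒≤ m<b , unhidden
    where
    unhidden : ∀ x y → Edge D x y → a ≤ x → x < m → m < y → y ≤ b → x ≡ a × y ≡ b
    unhidden x y xy a≤x x<m m<y y≤b with a Fin.≟ x
    ... | no  a≢x  = ⊥-elim (crossless am xy (≢∧≤⇒< a≢x a≤x) x<m m<y)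
    ... | yes refl with y Fin.≟ b
    ...   | yes y≡b = refl , y≡b
    ...   | no  y≢b = contradiction m<y (ℕ.≤⇒≯ (max (xy , ≢∧≤⇒< y≢b y≤b)))

  face-isPart : ∀ {a b} → Edge D a b → Wide (a , b) → IsPart D (face D (a , b))
  face-isPart {a} {b} ab wide = record
    { polygon = polygon
    ; edges   = λ i j i∈ j∈ i<j → mk⇔
        (consecutive⇒edge i∈ j∈ i<j)
        (edge⇒consecutive (visible⁻ i∈) (visible⁻ j∈)) }
    where
    visible⁻ : ∀ {v} → v Subset.∈ face D (a , b) → Visible D a b v
    visible⁻ = ∈-comprehension⁻ (visible? D a b)

    visible⁺ : ∀ {v} → Visible D a b v → v Subset.∈ face D (a , b)
    visible⁺ = ∈-comprehension⁺ (visible? D a b)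

    polygon : 3 ℕ.≤ ∣ face D (a , b) ∣
    polygon with m , a<m , m<b , vis ← interior wide = unique⇒length≤∣p∣ {xs = a ∷ m ∷ b ∷ []}
      ((Fin.<⇒≢ a<m ∷ Fin.<⇒≢ (ascending ab) ∷ []) ∷ (Fin.<⇒≢ m<b ∷ []) ∷ [] ∷ [])
      λ { (here refl)                 → visible⁺ (visible-left (ℕ.<⇒≤ (ascending ab)))
        ; (there (here refl))         → visible⁺ vis
        ; (there (there (here refl))) → visible⁺ (visible-right (ℕ.<⇒≤ (ascending ab))) }

    -- An edge other than `(a , b)` hides everything strictly inside it, so no vertex of the face is
    -- left there; `(a , b)` itself is the closing side.
    edge⇒consecutive : ∀ {i j} → Visible D a b i → Visible D a b j → Edge D i j →
                       Consecutive (face D (a , b)) (i , j)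
    edge⇒consecutive {i} {j} (a≤i , _) (_ , j≤b , _) ij with (i Fin.≟ a) ×-dec (j Fin.≟ b)
    ... | yes (refl , refl) = inj₂ λ l l∈ → bounds (face-ends (ℕ.<⇒≤ (ascending ab))) l∈
    ... | no  ij≢ab = inj₁ λ l l∈ (i<l , l<j) →
      ij≢ab (proj₂ (proj₂ (visible⁻ l∈)) i j ij a≤i i<l l<j j≤b)

    consecutive⇒edge : ∀ {i j} → i Subset.∈ face D (a , b) → j Subset.∈ face D (a , b) → i < j →
                       Consecutive (face D (a , b)) (i , j) → Edge D i j
    consecutive⇒edge {i} {j} i∈ j∈ _ (inj₂ all) =
      subst₂ (Edge D)
        (Fin.≤-antisym (proj₁ (bounds E i∈)) (proj₁ (all a (left∈ E))))
        (Fin.≤-antisym (proj₂ (all b (right∈ E))) (proj₂ (bounds E j∈)))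
        ab
      where
      E = face-ends (ℕ.<⇒≤ (ascending ab))
    consecutive⇒edge {i} {j} i∈ j∈ i<j (inj₁ none)
      with a≤i , _ , vis-i ← visible⁻ i∈ | _ , j≤b , vis-j ← visible⁻ j∈
      -- `q` ends the longest edge from `i` that does not pass `j`. If `q` is not `j`, it is visible
      -- and lies strictly between two consecutive vertices: an edge hiding it would cross
      -- `(i , q)`, contradict the choice of `q`, or hide `i` or `j` as well and hence be `(a , b)`.
      with s , s≡1+i ← successor {i} {j} i<j
      with q , _ , (iq , q≤j) , max ← greatest {P = λ l → Edge D i l × l ≤ j}
             (λ l → edge? D i l ×-dec (l Fin.≤? j))
             {s} (inj₁ (inj₁ s≡1+i) , subst (ℕ._≤ toℕ j) (sym s≡1+i) i<j)
      with q Fin.≟ j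
    ... | yes refl = iq
    ... | no  q≢j  = ⊥-elim (none q (visible⁺ (a≤q , q≤b , unhidden)) (ascending iq , q<j))
      where
      q<j = ≢∧≤⇒< q≢j q≤j
      a≤q = ℕ.≤-trans a≤i (ℕ.<⇒≤ (ascending iq))
      q≤b = ℕ.≤-trans q≤j j≤b
      unhidden : ∀ x y → Edge D x y → a ≤ x → x < q → q < y → y ≤ b → x ≡ a × y ≡ b
      unhidden x y xy a≤x x<q q<y y≤b with Fin.<-cmp x i
      ... | tri< x<i _ _ = vis-i x y xy a≤x x<i (ℕ.<-trans (ascending iq) q<y) y≤b
      ... | tri> _ _ i<x = ⊥-elim (crossless iq xy i<x x<q q<y)
      ... | tri≈ _ refl _ with ℕ.≤-<-connex (toℕ y) (toℕ j)
      ...   | inj₁ y≤j = contradiction q<y (ℕ.≤⇒≯ (max (xy , y≤j)))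
      ...   | inj₂ j<y = vis-j x y xy a≤x i<j j<y y≤b

  between : ∀ {S a b} → IsPart D S → Ends S a b → ∃[ t ] t Subset.∈ S × a < t × t < b
  between {S} {a} {b} part E
    with Fin.any? (λ t → (t Subset.∈? S) ×-dec (a Fin.<? t) ×-dec (t Fin.<? b))
  ... | yes found = found
  ... | no  none  = contradiction
    (ℕ.≤-trans (IsPart.polygon part) (covered⇒∣p∣≤length (a ∷ b ∷ []) only)) λ { (s≤s (s≤s ())) }
    where
    only : ∀ {x} → x Subset.∈ S → x ∈ a ∷ b ∷ []
    only {x} x∈ with x Fin.≟ a | x Fin.≟ b
    ... | yes x≡a | _       = here x≡a
    ... | no  _   | yes x≡b = there (here x≡b)
    ... | no  x≢a | no  x≢b = contradiction
      (x , x∈ , ≢∧≤⇒< (x≢a ∘ sym) (proj₁ (bounds E x∈)) , ≢∧≤⇒< x≢b (proj₂ (bounds E x∈))) none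

  ends-edge : ∀ {S a b} → IsPart D S → Ends S a b → Edge D a b
  ends-edge {a = a} {b} part E = Equivalence.to
    (IsPart.edges part a b (left∈ E) (right∈ E)
      (let _ , _ , a<t , t<b = between part E in ℕ.<-trans a<t t<b))
    (inj₂ λ _ → bounds E)

  ends-wide : ∀ {S a b} → IsPart D S → Ends S a b → Wide (a , b)
  ends-wide part E = let _ , _ , a<t , t<b = between part E in ℕ.≤-<-trans a<t t<b

  part-ends : ∀ {S} → IsPart D S → ∃[ a ] ∃[ b ] Ends S a b
  part-ends {S} part with Subset.nonempty? S
  ... | no  empty = contradiction
    (ℕ.≤-trans (IsPart.polygon part) (covered⇒∣p∣≤length [] λ x∈ → ⊥-elim (empty (_ , x∈)))) λ ()
  ... | yes (x , x∈)
    with a , _ , a∈ , min ← least (Subset._∈? S) x∈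
       | b , _ , b∈ , max ← greatest (Subset._∈? S) x∈
    = a , b , record { left∈ = a∈ ; right∈ = b∈ ; bounds = λ l∈ → min l∈ , max l∈ }

  gap-edge : ∀ {S p q} → IsPart D S → p Subset.∈ S → q Subset.∈ S → p < q →
             (∀ {l} → l Subset.∈ S → ¬ (p < l × l < q)) → Edge D p q
  gap-edge part p∈ q∈ p<q none =
    Equivalence.to (IsPart.edges part _ _ p∈ q∈ p<q) (inj₁ λ _ l∈ → none l∈)

  -- Neighbouring vertices of `S` are joined by edges. An edge over a vertex of `S` cannot have an
  -- end strictly inside a gap of `S`, since it would cross the edge that spans the gap; and a
  -- vertex outside `S` that lies in a gap is hidden by this edge.
  part≡face : ∀ {S a b} → IsPart D S → Ends S a b → S ≡ face D (a , b)
  part≡face {S} {a} {b} part E = Subset.⊆-antisym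
    (λ v∈ → ∈-comprehension⁺ (visible? D a b)
      (let a≤v , v≤b = bounds E v∈ in a≤v , v≤b , unhidden v∈))
    (λ v∈ → seen (∈-comprehension⁻ (visible? D a b) v∈))
    where
    unhidden : ∀ {v} → v Subset.∈ S →
               ∀ x y → Edge D x y → a ≤ x → x < v → v < y → y ≤ b → x ≡ a × y ≡ b
    unhidden {v} v∈ x y xy a≤x x<v v<y y≤b
      with p  , _ , (p∈  , p≤x)  , p-max  ←
             greatest (λ l → (l Subset.∈? S) ×-dec (l Fin.≤? x)) (left∈ E , a≤x)
         | p′ , p′≤v , (p′∈ , x<p′) , p′-min ←
             least (λ l → (l Subset.∈? S) ×-dec (x Fin.<? l)) (v∈ , x<v)
         | q  , v≤q , (q∈  , q<y)  , q-max  ←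
             greatest (λ l → (l Subset.∈? S) ×-dec (l Fin.<? y)) (v∈ , v<y)
         | q′ , _ , (q′∈ , y≤q′) , q′-min ←
             least (λ l → (l Subset.∈? S) ×-dec (y Fin.≤? l)) (right∈ E , y≤b)
      with p Fin.≟ x | y Fin.≟ q′
    ... | no  p≢x  | _ = ⊥-elim (crossless
          (gap-edge part p∈ p′∈ (ℕ.≤-<-trans p≤x x<p′) λ {l} l∈ (p<l , l<p′) →
            contradiction l<p′ (ℕ.≤⇒≯ (p′-min (l∈ , ℕ.≰⇒> λ l≤x → ℕ.<⇒≱ p<l (p-max (l∈ , l≤x))))))
          xy (≢∧≤⇒< p≢x p≤x) x<p′ (ℕ.≤-<-trans p′≤v v<y))
    ... | yes refl | no y≢q′ = ⊥-elim (crossless xy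
          (gap-edge part q∈ q′∈ (ℕ.<-≤-trans q<y y≤q′) λ {l} l∈ (q<l , l<q′) →
            contradiction q<l (ℕ.≤⇒≯ (q-max (l∈ , ℕ.≰⇒> λ y≤l → ℕ.<⇒≱ l<q′ (q′-min (l∈ , y≤l))))))
          (ℕ.<-≤-trans x<v v≤q) q<y (≢∧≤⇒< y≢q′ y≤q′))
    -- Both ends now lie in `S`, so the edge is a side of the hull of `S`; with `v` between its ends
    -- it can only be the closing side `(a , b)`.
    ... | yes refl | yes refl with Equivalence.from (IsPart.edges part x y p∈ q′∈ (ascending xy)) xy
    ...   | inj₁ none = ⊥-elim (none v v∈ (x<v , v<y))
    ...   | inj₂ all  = Fin.≤-antisym (proj₁ (all a (left∈ E))) a≤x ,
                        Fin.≤-antisym y≤b (proj₂ (all b (right∈ E)))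

    seen : ∀ {v} → Visible D a b v → v Subset.∈ S
    seen {v} (a≤v , v≤b , vis)
      with p , _ , (p∈ , p≤v) , p-max ←
             greatest (λ l → (l Subset.∈? S) ×-dec (l Fin.≤? v)) (left∈ E , a≤v)
         | q , _ , (q∈ , v≤q) , q-min ←
             least (λ l → (l Subset.∈? S) ×-dec (v Fin.≤? l)) (right∈ E , v≤b)
      with p Fin.≟ v | v Fin.≟ q
    ... | yes refl | _        = p∈
    ... | no  _    | yes refl = q∈
    -- The edge `(p , q)` over the gap around `v` hides it unless it is `(a , b)`; but then `S`
    -- would have no vertex between its ends.
    ... | no  p≢v  | no  v≢q  = ⊥-elim (none t∈ (subst (_< t) (sym p≡a) a<t , subst (t <_) (sym q≡b) t<b))
      where
      p<v = ≢∧≤⇒< p≢v p≤v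
      v<q = ≢∧≤⇒< v≢q v≤q
      none : ∀ {l} → l Subset.∈ S → ¬ (p < l × l < q)
      none {l} l∈ (p<l , l<q) with ℕ.≤-<-connex (toℕ l) (toℕ v)
      ... | inj₁ l≤v = ℕ.<⇒≱ p<l (p-max (l∈ , l≤v))
      ... | inj₂ v<l = ℕ.<⇒≱ l<q (q-min (l∈ , ℕ.<⇒≤ v<l))
      hit : p ≡ a × q ≡ b
      hit = vis p q (gap-edge part p∈ q∈ (ℕ.<-trans p<v v<q) none)
              (proj₁ (bounds E p∈)) p<v v<q (proj₂ (bounds E q∈))
      p≡a = proj₁ hit
      q≡b = proj₂ hit
      inner = between part E
      t = proj₁ inner
      t∈ = proj₁ (proj₂ inner)
      a<t = proj₁ (proj₂ (proj₂ inner))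
      t<b = proj₂ (proj₂ (proj₂ inner))

  -- Compares the first and the last vertex of `S` strictly between `a` and `b`: if they coincide,
  -- this vertex is a neighbour of both `a` and `b`.
  triangle-or-more : ∀ {S a b} → IsPart D S → Ends S a b →
    (∃[ m ] Apex D a b m) ⊎
    (∃[ v ] ∃[ w ] v Subset.∈ S × w Subset.∈ S × a < v × v < w × w < b)
  triangle-or-more {S} {a} {b} part E
    with t , t∈ , a<t , t<b ← between part E
    with p , p≤t , (p∈ , a<p) , p-min ← least (λ l → (l Subset.∈? S) ×-dec (a Fin.<? l)) (t∈ , a<t)
       | q , t≤q , (q∈ , q<b) , q-max ←
             greatest (λ l → (l Subset.∈? S) ×-dec (l Fin.<? b)) (t∈ , t<b)
    with p Fin.≟ q
  ... | no  p≢q  = inj₂ (p , q , p∈ , q∈ , a<p , ≢∧≤⇒< p≢q (ℕ.≤-trans p≤t t≤q) , q<b)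
  ... | yes refl = inj₁ (p , a<p , q<b ,
    gap-edge part (left∈ E) p∈ a<p (λ l∈ (a<l , l<p) → ℕ.<⇒≱ l<p (p-min (l∈ , a<l))) ,
    gap-edge part p∈ (right∈ E) q<b (λ l∈ (p<l , l<b) → ℕ.<⇒≱ p<l (q-max (l∈ , l<b))))

  triangle-apex : ∀ {S a b} → IsPart D S → Ends S a b → IsTriangle S → ∃[ m ] Apex D a b m
  triangle-apex {a = a} {b} part E ∣S∣≡3 with triangle-or-more part E
  ... | inj₁ apex = apex
  ... | inj₂ (v , w , v∈ , w∈ , a<v , v<w , w<b) = contradiction
    (subst (4 ℕ.≤_) ∣S∣≡3 (unique⇒length≤∣p∣ {xs = a ∷ v ∷ w ∷ b ∷ []} distinct
      λ { (here refl)                         → left∈ E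
        ; (there (here refl))                 → v∈
        ; (there (there (here refl)))         → w∈
        ; (there (there (there (here refl)))) → right∈ E }))
    λ { (s≤s (s≤s (s≤s ()))) }
    where
    a<w = ℕ.<-trans a<v v<w
    v<b = ℕ.<-trans v<w w<b
    distinct : Unique (a ∷ v ∷ w ∷ b ∷ [])
    distinct = (Fin.<⇒≢ a<v ∷ Fin.<⇒≢ a<w ∷ Fin.<⇒≢ (ℕ.<-trans a<w w<b) ∷ [])
      ∷ (Fin.<⇒≢ v<w ∷ Fin.<⇒≢ v<b ∷ []) ∷ (Fin.<⇒≢ w<b ∷ []) ∷ [] ∷ []

  -- The edges `(a , m)` and `(m , b)` hide every vertex strictly inside them, which leaves `a`, `m`
  -- and `b`. The vertex `m` is visible because an edge over it within `(a , b)`, other than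
  -- `(a , b)`, would cross one of the two.
  apex-triangle : ∀ {a b m} → Apex D a b m → IsTriangle (face D (a , b))
  apex-triangle {a} {b} {m} (a<m , m<b , am , mb) =
    trans (cong ∣_∣ (Subset.⊆-antisym to from)) (∣fromList∣ distinct)
    where
    distinct : Unique (a ∷ m ∷ b ∷ [])
    distinct = (Fin.<⇒≢ a<m ∷ Fin.<⇒≢ (ℕ.<-trans a<m m<b) ∷ []) ∷ (Fin.<⇒≢ m<b ∷ []) ∷ [] ∷ []

    a≤b = ℕ.<⇒≤ (ℕ.<-trans a<m m<b)

    to : face D (a , b) Subset.⊆ fromList (a ∷ m ∷ b ∷ [])
    to {v} v∈ = ∈-fromList⁺ (locate (Fin.<-cmp v m) (v Fin.≟ a) (v Fin.≟ b))
      where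
      vis = ∈-comprehension⁻ (visible? D a b) v∈
      locate : _ → _ → _ → v ∈ a ∷ m ∷ b ∷ []
      locate _ (yes v≡a) _ = here v≡a
      locate _ _ (yes v≡b) = there (there (here v≡b))
      locate (tri≈ _ v≡m _) _ _ = there (here v≡m)
      locate (tri< v<m _ _) (no v≢a) _ = contradiction
        (proj₂ (proj₂ (proj₂ vis) a m am ℕ.≤-refl (≢∧≤⇒< (v≢a ∘ sym) (proj₁ vis)) v<m (ℕ.<⇒≤ m<b)))
        (Fin.<⇒≢ m<b)
      locate (tri> _ _ m<v) _ (no v≢b) = contradiction
        (sym (proj₁ (proj₂ (proj₂ vis) m b mb (ℕ.<⇒≤ a<m) m<v (≢∧≤⇒< v≢b (proj₁ (proj₂ vis))) ℕ.≤-refl)))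
        (Fin.<⇒≢ a<m)

    unhidden : ∀ x y → Edge D x y → a ≤ x → x < m → m < y → y ≤ b → x ≡ a × y ≡ b
    unhidden x y xy a≤x x<m m<y y≤b with a Fin.≟ x | y Fin.≟ b
    ... | no  a≢x | _       = ⊥-elim (crossless am xy (≢∧≤⇒< a≢x a≤x) x<m m<y)
    ... | yes _   | no  y≢b = ⊥-elim (crossless xy mb x<m m<y (≢∧≤⇒< y≢b y≤b))
    ... | yes a≡x | yes y≡b = sym a≡x , y≡b

    from : fromList (a ∷ m ∷ b ∷ []) Subset.⊆ face D (a , b)
    from v∈ with ∈-fromList⁻ (a ∷ m ∷ b ∷ []) v∈
    ... | here refl                 = left∈ (face-ends a≤b)
    ... | there (here refl)         =
      ∈-comprehension⁺ (visible? D a b) (ℕ.<⇒≤ a<m , ℕ.<⇒≤ m<b , unhidden)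
    ... | there (there (here refl)) = right∈ (face-ends a≤b)

  -- Two edges over the same `v` that do not cross are nested, and the inner one hides `v` from the
  -- outer one unless they are equal.
  owner-unique : ∀ {a b c d v} → Edge D a b → Edge D c d →
                 Visible D a b v → Visible D c d v →
                 a < v → v < b → c < v → v < d → a ≡ c × b ≡ d
  owner-unique {a} {b} {c} {d} ab cd (_ , _ , ab-vis) (_ , _ , cd-vis) a<v v<b c<v v<d
    with Fin.<-cmp a c | ℕ.≤-<-connex (toℕ d) (toℕ b) | ℕ.≤-<-connex (toℕ b) (toℕ d)
  ... | tri< a<c _ _   | inj₁ d≤b | _ =
    let c≡a , d≡b = ab-vis c d cd (ℕ.<⇒≤ a<c) c<v v<d d≤b in sym c≡a , sym d≡b
  ... | tri< a<c _ _   | inj₂ b<d | _ = ⊥-elim (crossless ab cd a<c (ℕ.<-trans c<v v<b) b<d)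
  ... | tri≈ _ refl _  | inj₁ d≤b | _ =
    let c≡a , d≡b = ab-vis c d cd ℕ.≤-refl c<v v<d d≤b in sym c≡a , sym d≡b
  ... | tri≈ _ refl _  | inj₂ b<d | _ = cd-vis a b ab ℕ.≤-refl a<v v<b (ℕ.<⇒≤ b<d)
  ... | tri> _ _ c<a   | _ | inj₁ b≤d = cd-vis a b ab (ℕ.<⇒≤ c<a) a<v v<b b≤d
  ... | tri> _ _ c<a   | _ | inj₂ d<b = ⊥-elim (crossless cd ab c<a (ℕ.<-trans a<v v<d) d<b)

-- Binary trees drawn in the n-gon

data Shape : Set where
  leaf : Shape
  fork : Shape → Shape → Shape

module _ {n : ℕ} where

  private
    variable
      s t : Shape
      ts ts′ : Vec Shape r
      c c′ : List (Shape ⊎ Shape)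
      i j m g h v x y : Fin n

  -- A binary tree whose leaves are the sides of the n-gon from i to j and whose
  -- nodes are the triangles of a triangulation of the polygon they enclose.

  data Span : Shape → Fin n → Fin n → Set where
    side : toℕ j ≡ suc (toℕ i) → Span leaf i j
    fork : Span s i m → Span t m j → Span (fork s t) i j

  -- The trees that hang from the sides of the marked polygon, except for the
  -- side (g , h) that separates it from the side (0 , n − 1) of the n-gon.

  data Chain : ∀ {r} → Vec Shape r → Fin n → Fin n → Set where
    []  : Chain [] i i
    _∷_ : Span t i m → Chain ts m j → Chain (t ∷ ts) i j

  -- The triangles between (i , j) and (g , h), the outermost first; each has on
  -- its other side a tree, which follows (inj₁) or precedes (inj₂) the segment (g , h).

  data Around : List (Shape ⊎ Shape) → (i j g h : Fin n) → Set where
    here  : Around [] i j i j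
    left  : Around c i m g h → Span t m j → Around (inj₁ t ∷ c) i j g h
    right : Span t i m → Around c m j g h → Around (inj₂ t ∷ c) i j g h

  -- The segments under the nodes; for chordsᵃ, including (i , j) and (g , h), and
  -- with xs the chords below (g , h).

  chordsˢ : Span t i j → List (Segment n)
  chordsˢ                 (side _)   = []
  chordsˢ {i = i} {j = j} (fork l r) = (i , j) ∷ chordsˢ l ++ chordsˢ r

  chordsᶜ : Chain ts i j → List (Segment n)
  chordsᶜ []       = []
  chordsᶜ (s ∷ ss) = chordsˢ s ++ chordsᶜ ss

  chordsᵃ : Around c i j g h → List (Segment n) → List (Segment n)
  chordsᵃ {i = i} {j = j} here        xs = (i , j) ∷ xs
  chordsᵃ {i = i} {j = j} (left a s)  xs = (i , j) ∷ chordsᵃ a xs ++ chordsˢ s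
  chordsᵃ {i = i} {j = j} (right s a) xs = (i , j) ∷ chordsˢ s ++ chordsᵃ a xs

  corners : Chain ts i j → List (Fin n)
  corners {i = i} []       = i ∷ []
  corners {i = i} (s ∷ ss) = i ∷ corners ss

  span-< : Span t i j → i < j
  span-< (side j≡1+i) = ℕ.≤-reflexive (sym j≡1+i)
  span-< (fork l r)   = ℕ.<-trans (span-< l) (span-< r)

  chain-≤ : Chain ts i j → i ≤ j
  chain-≤ []       = ℕ.≤-refl
  chain-≤ (s ∷ ss) = ℕ.≤-trans (ℕ.<⇒≤ (span-< s)) (chain-≤ ss)

  chain-< : {ts : Vec Shape (suc r)} → Chain ts i j → i < j
  chain-< (s ∷ ss) = ℕ.<-≤-trans (span-< s) (chain-≤ ss)

  around-≤ : Around c i j g h → i ≤ g × h ≤ j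
  around-≤ here        = ℕ.≤-refl , ℕ.≤-refl
  around-≤ (left a s)  = let i≤g , h≤m = around-≤ a in i≤g , ℕ.≤-trans h≤m (ℕ.<⇒≤ (span-< s))
  around-≤ (right s a) = let m≤g , h≤j = around-≤ a in ℕ.≤-trans (ℕ.<⇒≤ (span-< s)) m≤g , h≤j

  around-< : Around c i j g h → g < h → i < j
  around-< a g<h = let i≤g , h≤j = around-≤ a in ℕ.≤-<-trans i≤g (ℕ.<-≤-trans g<h h≤j)

  corners-≤ : (ss : Chain ts i j) → v ∈ corners ss → i ≤ v × v ≤ j
  corners-≤ []       (here refl) = ℕ.≤-refl , ℕ.≤-refl
  corners-≤ (s ∷ ss) (here refl) = ℕ.≤-refl , chain-≤ (s ∷ ss)
  corners-≤ (s ∷ ss) (there v∈)  =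
    let m≤v , v≤j = corners-≤ ss v∈ in ℕ.≤-trans (ℕ.<⇒≤ (span-< s)) m≤v , v≤j

  first-corner : (ss : Chain ts i j) → i ∈ corners ss
  first-corner []       = here refl
  first-corner (s ∷ ss) = here refl

  last-corner : (ss : Chain ts i j) → j ∈ corners ss
  last-corner []       = here refl
  last-corner (s ∷ ss) = there (last-corner ss)

  corners-unique : (ss : Chain ts i j) → Unique (corners ss)
  corners-unique []       = [] ∷ []
  corners-unique (s ∷ ss) =
    All.tabulate (λ v∈ → Fin.<⇒≢ (ℕ.<-≤-trans (span-< s) (proj₁ (corners-≤ ss v∈)))) ∷ corners-unique ss

  length-corners : {ts : Vec Shape r} (ss : Chain ts i j) → length (corners ss) ≡ suc r
  length-corners []       = refl
  length-corners (s ∷ ss) = cong suc (length-corners ss)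

  gon-ends : (ss : Chain ts i j) → Ends (fromList (corners ss)) i j
  gon-ends ss = record
    { left∈  = ∈-fromList⁺ (first-corner ss)
    ; right∈ = ∈-fromList⁺ (last-corner ss)
    ; bounds = λ l∈ → corners-≤ ss (∈-fromList⁻ _ l∈) }

  outer∈ : (a : Around c i j g h) (xs : List (Segment n)) → (i , j) ∈ chordsᵃ a xs
  outer∈ here        xs = here refl
  outer∈ (left _ _)  xs = here refl
  outer∈ (right _ _) xs = here refl

  inner∈ : (a : Around c i j g h) (xs : List (Segment n)) → (g , h) ∈ chordsᵃ a xs
  inner∈ here        xs = here refl
  inner∈ (left a _)  xs = there (∈-++⁺ˡ (inner∈ a xs))
  inner∈ (right s a) xs = there (∈-++⁺ʳ (chordsˢ s) (inner∈ a xs))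

  base⊆ : (a : Around c i j g h) {xs : List (Segment n)} {d : Segment n} → d ∈ xs → d ∈ chordsᵃ a xs
  base⊆ here        d∈ = there d∈
  base⊆ (left a _)  d∈ = there (∈-++⁺ˡ (base⊆ a d∈))
  base⊆ (right s a) d∈ = there (∈-++⁺ʳ (chordsˢ s) (base⊆ a d∈))

  -- `Edge D` instead of membership in `D`, because the outermost chord is the side (0 , n - 1) and
  -- not a diagonal.
  Drawn : List (Segment n) → List (Segment n) → Set
  Drawn D = All (uncurry (Edge D))

  -- A drawing determines its trees

  module Uniqueness {D : List (Segment n)} (L : Laminar D) where

    open Laminar L

    span-edge : (p : Span t i j) → Drawn D (chordsˢ p) → Edge D i j
    span-edge (side j≡1+i) _        = inj₁ (inj₁ j≡1+i)
    span-edge (fork _ _)   (ij ∷ _) = ij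

    around-edge : (a : Around c i j g h) {xs : List (Segment n)} → Drawn D (chordsᵃ a xs) → Edge D i j
    around-edge a dr = All.lookup dr (outer∈ a _)

    unforked : Span t i m → Span s m j → toℕ j ≡ suc (toℕ i) → ⊥
    unforked l r j≡1+i = ℕ.<⇒≱ (span-< r) (subst (ℕ._≤ _) (sym j≡1+i) (span-< l))

    -- If the two apexes differed, the edge from `i` to the larger one would cross the edge from the
    -- smaller one to `j`.
    same-apex : ∀ {i m m′ j} → Edge D i m → Edge D m j → Edge D i m′ → Edge D m′ j → m ≡ m′
    same-apex {m = m} {m′} im mj im′ m′j with Fin.<-cmp m m′
    ... | tri< m<m′ _ _ = ⊥-elim (crossless im′ mj (ascending im) m<m′ (ascending m′j))
    ... | tri≈ _ m≡m′ _ = m≡m′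
    ... | tri> _ _ m′<m = ⊥-elim (crossless im m′j (ascending im′) m′<m (ascending mj))

    span-unique : (p : Span s i j) (q : Span t i j) → Drawn D (chordsˢ p) → Drawn D (chordsˢ q) → s ≡ t
    span-unique (side _)     (side _)     _        _        = refl
    span-unique (side j≡1+i) (fork l r)   _        _        = ⊥-elim (unforked l r j≡1+i)
    span-unique (fork l r)   (side j≡1+i) _        _        = ⊥-elim (unforked l r j≡1+i)
    span-unique (fork l r)   (fork l′ r′) (_ ∷ dr) (_ ∷ dr′)
      with dl , dr ← All.++⁻ (chordsˢ l) dr | dl′ , dr′ ← All.++⁻ (chordsˢ l′) dr′
      with refl ← same-apex (span-edge l dl) (span-edge r dr) (span-edge l′ dl′) (span-edge r′ dr′)
      = cong₂ fork (span-unique l l′ dl dl′) (span-unique r r′ dr dr′)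

    later : ∀ {v vs} → i < v → v ∈ i ∷ vs → v ∈ vs
    later i<i (here refl) = contradiction i<i (ℕ.<-irrefl refl)
    later _   (there v∈)  = v∈

    -- The corner after `i` is the least corner above `i`. As the corner sets agree, both chains
    -- break at the same vertex.
    chain-unique : {ts ts′ : Vec Shape r} (p : Chain ts i j) (q : Chain ts′ i j) →
                   Drawn D (chordsᶜ p) → Drawn D (chordsᶜ q) →
                   (∀ {v} → v ∈ corners p → v ∈ corners q) → (∀ {v} → v ∈ corners q → v ∈ corners p) →
                   ts ≡ ts′
    chain-unique []      []      _  _   _ _ = refl
    chain-unique {i = i} (_∷_ {m = m} s p) (_∷_ {m = m′} t q) dr dr′ p⊆q q⊆p
      with ds , dp ← All.++⁻ (chordsˢ s) dr | dt , dq ← All.++⁻ (chordsˢ t) dr′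
      with refl ← Fin.≤-antisym {i = m} {m′}
                    (proj₁ (corners-≤ p (later (span-< t) (q⊆p (there (first-corner q))))))
                    (proj₁ (corners-≤ q (later (span-< s) (p⊆q (there (first-corner p))))))
      = cong₂ _∷_ (span-unique s t ds dt)
        (chain-unique p q dp dq
          (λ v∈ → later (ℕ.<-≤-trans (span-< s) (proj₁ (corners-≤ p v∈))) (p⊆q (there v∈)))
          (λ v∈ → later (ℕ.<-≤-trans (span-< t) (proj₁ (corners-≤ q v∈))) (q⊆p (there v∈))))
    -- The apex `m` of the outermost triangle is forced by `same-apex`. Its tree cannot lie on the
    -- left in one reading and on the right in the other, since this would give h ≤ m ≤ g.
    around-unique : (a : Around c i j g h) (b : Around c′ i j g h) {xs ys : List (Segment n)} → g < h →
                    Drawn D (chordsᵃ a xs) → Drawn D (chordsᵃ b ys) → c ≡ c′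
    around-unique here        here         _ _ _ = refl
    around-unique here        (left b s)   _ _ _ = contradiction (span-< s) (ℕ.≤⇒≯ (proj₂ (around-≤ b)))
    around-unique here        (right s b)  _ _ _ = contradiction (span-< s) (ℕ.≤⇒≯ (proj₁ (around-≤ b)))
    around-unique (left a s)  here         _ _ _ = contradiction (span-< s) (ℕ.≤⇒≯ (proj₂ (around-≤ a)))
    around-unique (right s a) here         _ _ _ = contradiction (span-< s) (ℕ.≤⇒≯ (proj₁ (around-≤ a)))
    around-unique (left a s)  (left b t)   g<h (_ ∷ da) (_ ∷ db)
      with da , ds ← All.++⁻ (chordsᵃ a _) da | db , dt ← All.++⁻ (chordsᵃ b _) db
      with refl ← same-apex (around-edge a da) (span-edge s ds) (around-edge b db) (span-edge t dt)
      = cong₂ _∷_ (cong inj₁ (span-unique s t ds dt)) (around-unique a b g<h da db)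
    around-unique (right s a) (right t b)  g<h (_ ∷ da) (_ ∷ db)
      with ds , da ← All.++⁻ (chordsˢ s) da | dt , db ← All.++⁻ (chordsˢ t) db
      with refl ← same-apex (span-edge s ds) (around-edge a da) (span-edge t dt) (around-edge b db)
      = cong₂ _∷_ (cong inj₂ (span-unique s t ds dt)) (around-unique a b g<h da db)
    around-unique (left a s)  (right t b)  g<h (_ ∷ da) (_ ∷ db)
      with da , ds ← All.++⁻ (chordsᵃ a _) da | dt , db ← All.++⁻ (chordsˢ t) db
      with refl ← same-apex (around-edge a da) (span-edge s ds) (span-edge t dt) (around-edge b db)
      = contradiction g<h (ℕ.≤⇒≯ (ℕ.≤-trans (proj₂ (around-≤ a)) (proj₁ (around-≤ b))))
    around-unique (right s a) (left b t)   g<h (_ ∷ da) (_ ∷ db)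
      with ds , da ← All.++⁻ (chordsˢ s) da | db , dt ← All.++⁻ (chordsᵃ b _) db
      with refl ← same-apex (span-edge s ds) (around-edge a da) (around-edge b db) (span-edge t dt)
      = contradiction g<h (ℕ.≤⇒≯ (ℕ.≤-trans (proj₂ (around-≤ b)) (proj₁ (around-≤ a))))

  -- Reading a drawing off a dissection

  HasApex : List (Segment n) → Segment n → Set
  HasApex D (i , j) = ∃[ m ] Apex D i j m

  module Parsing
    {D : List (Segment n)} (L : Laminar D)
    {G : Subset n} {g h : Fin n} (part : IsPart D G) (ends : Ends G g h)
    (apex : ∀ {i j} → Edge D i j → Wide (i , j) → ¬ (i ≡ g × j ≡ h) → HasApex D (i , j))
    where

    open Laminar L
    open Ends ends
    open Faces L

    narrower-left : ∀ {i m j : Fin n} → i < m → m < j → toℕ m ∸ toℕ i ℕ.< toℕ j ∸ toℕ i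
    narrower-left i<m m<j = ℕ.∸-monoˡ-< m<j (ℕ.<⇒≤ i<m)

    narrower-right : ∀ {i m j : Fin n} → i < m → m < j → toℕ j ∸ toℕ m ℕ.< toℕ j ∸ toℕ i
    narrower-right i<m m<j = ℕ.∸-monoʳ-< i<m (ℕ.<⇒≤ m<j)

    -- Since `(g , h)` does not lie within `(i , j)`, the marked polygon is never met on the way
    -- down: each wide edge has an apex, and both edges to it are shorter and inherit the condition.
    parse-span : ∀ {i j} → Edge D i j → ¬ (i ≤ g × h ≤ j) →
                 ∃[ t ] Σ[ s ∈ Span t i j ] Drawn D (chordsˢ s)
    parse-span = go (ℕ.<-wellFounded _)
      where
      go : ∀ {i j} → Acc ℕ._<_ (toℕ j ∸ toℕ i) → Edge D i j → ¬ (i ≤ g × h ≤ j) →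
           ∃[ t ] Σ[ s ∈ Span t i j ] Drawn D (chordsˢ s)
      go {i} {j} (acc rs) ij out with ℕ.m≤n⇒m<n∨m≡n (ascending ij)
      ... | inj₂ 1+i≡j = leaf , side (sym 1+i≡j) , []
      ... | inj₁ wide
        with m , i<m , m<j , im , mj ← apex ij wide
               (λ { (refl , refl) → out (ℕ.≤-refl , ℕ.≤-refl) })
        with s , l , dl ← go (rs (narrower-left {i} i<m m<j)) im
               (λ (i≤g , h≤m) → out (i≤g , ℕ.≤-trans h≤m (ℕ.<⇒≤ m<j)))
           | t , r , dr ← go (rs (narrower-right i<m m<j)) mj
               (λ (m≤g , h≤j) → out (ℕ.≤-trans (ℕ.<⇒≤ i<m) m≤g , h≤j))
        = fork s t , fork l r , ij ∷ All.++⁺ dl dr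

    -- Follows the path of triangles from `(i , j)` down to `(g , h)`: the apex lies to the right of
    -- `(g , h)` or to its left, and the recursion enters the half that contains `(g , h)`.
    parse-around : ∀ {i j xs} → Edge D i j → i ≤ g → h ≤ j → Drawn D xs →
                   ∃[ c ] Σ[ a ∈ Around c i j g h ] Drawn D (chordsᵃ a xs)
    parse-around = go (ℕ.<-wellFounded _)
      where
      gh = ends-edge part ends
      g<h = ascending gh
      go : ∀ {i j xs} → Acc ℕ._<_ (toℕ j ∸ toℕ i) → Edge D i j → i ≤ g → h ≤ j → Drawn D xs →
           ∃[ c ] Σ[ a ∈ Around c i j g h ] Drawn D (chordsᵃ a xs)
      go {i} {j} (acc rs) ij i≤g h≤j dxs with (i Fin.≟ g) ×-dec (j Fin.≟ h)
      ... | yes (refl , refl) = [] , here , ij ∷ dxs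
      ... | no  ij≢gh
        with m , i<m , m<j , im , mj ← apex ij
               -- If j = i + 1, then i ≤ g < h ≤ j would force `(i , j)` to be `(g , h)`.
               (ℕ.≤∧≢⇒< (ascending ij) λ 1+i≡j → ij≢gh
                 ( Fin.≤-antisym i≤g (ℕ.s≤s⁻¹ (ℕ.≤-trans g<h (ℕ.≤-trans h≤j (ℕ.≤-reflexive (sym 1+i≡j)))))
                 , Fin.≤-antisym (ℕ.≤-trans (ℕ.≤-reflexive (sym 1+i≡j)) (ℕ.≤-<-trans i≤g g<h)) h≤j))
               ij≢gh
        with ℕ.≤-<-connex (toℕ h) (toℕ m) | ℕ.≤-<-connex (toℕ m) (toℕ g)
      ... | inj₁ h≤m | _
        with c , a , da ← go (rs (narrower-left {i} i<m m<j)) im i≤g h≤m dxs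
           | t , s , ds ← parse-span mj (λ (m≤g , _) → ℕ.<⇒≱ (ℕ.<-≤-trans g<h h≤m) m≤g)
        = inj₁ t ∷ c , left a s , ij ∷ All.++⁺ da ds
      ... | inj₂ _ | inj₁ m≤g
        with c , a , da ← go (rs (narrower-right i<m m<j)) mj m≤g h≤j dxs
           | t , s , ds ← parse-span im (λ (_ , h≤m) → ℕ.<⇒≱ (ℕ.<-≤-trans g<h h≤m) m≤g)
        = inj₂ t ∷ c , right s a , ij ∷ All.++⁺ ds da
      -- With the apex strictly between `g` and `h`, one of its two edges would cross `(g , h)`.
      ... | inj₂ m<h | inj₂ g<m with i Fin.≟ g | h Fin.≟ j
      ...   | no i≢g   | _        = ⊥-elim (crossless im gh (≢∧≤⇒< i≢g i≤g) g<m m<h)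
      ...   | yes _    | no h≢j   = ⊥-elim (crossless gh mj g<m m<h (≢∧≤⇒< h≢j h≤j))
      ...   | yes i≡g  | yes h≡j  = ⊥-elim (ij≢gh (i≡g , sym h≡j))

    record Parsed (x : Fin n) : Set where
      field
        {size}   : ℕ
        {shapes} : Vec Shape size
        chain    : Chain shapes x h
        drawn    : Drawn D (chordsᶜ chain)
        sound    : ∀ {v} → v ∈ corners chain → v Subset.∈ G
        complete : ∀ {v} → v Subset.∈ G → x ≤ v → v ∈ corners chain

    parse-chain : Parsed g
    parse-chain = go (>-wellFounded g) left∈
      where
      go : ∀ {x} → Acc _>_ x → x Subset.∈ G → Parsed x
      go {x} (acc rs) x∈ with x Fin.≟ h
      ... | yes refl = record
        { chain = [] ; drawn = [] ; sound = λ { (here refl) → x∈ }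
        ; complete = λ v∈ h≤v → here (Fin.≤-antisym (proj₂ (bounds v∈)) h≤v) }
      ... | no  x≢h
        with y , _ , (y∈ , x<y) , min ← least (λ l → (l Subset.∈? G) ×-dec (x Fin.<? l))
               (right∈ , ≢∧≤⇒< x≢h (proj₂ (bounds x∈)))
        with t , s , ds ← parse-span
               (gap-edge part x∈ y∈ x<y λ l∈ (x<l , l<y) → ℕ.<⇒≱ l<y (min (l∈ , x<l)))
               -- The edge to the next vertex `y` of `G` cannot contain `(g , h)`: a vertex of `G`
               -- strictly between `g` and `h` would come before `y`.
               (λ (x≤g , h≤y) → let _ , t∈ , g<t , t<h = between part ends in
                  ℕ.<⇒≱ (ℕ.<-≤-trans t<h h≤y) (min (t∈ , ℕ.≤-<-trans x≤g g<t)))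
        = record
        { chain = s ∷ chain ; drawn = All.++⁺ ds drawn
        ; sound = λ { (here refl) → x∈ ; (there v∈) → sound v∈ }
        ; complete = λ v∈ x≤v → complete′ v∈ (ℕ.m≤n⇒m<n∨m≡n x≤v) }
        where
        open Parsed (go (rs x<y) y∈)
        complete′ : ∀ {v} → v Subset.∈ G → x < v ⊎ toℕ x ≡ toℕ v → v ∈ corners (s ∷ chain)
        complete′ v∈ (inj₁ x<v) = there (complete v∈ (min (v∈ , x<v)))
        complete′ v∈ (inj₂ x≡v) = here (Fin.toℕ-injective (sym x≡v))

  -- The chords of a drawing are distinct and do not cross

  record Tidy (i j : Fin n) (xs : List (Segment n)) : Set where
    field
      within    : ∀ {x y} → (x , y) ∈ xs → i ≤ x × y ≤ j × Wide (x , y)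
      distinct  : Unique xs
      crossfree : ∀ {a b c d} → (a , b) ∈ xs → (c , d) ∈ xs → a < c → c < b → b < d → ⊥

  open Tidy

  wide⇒< : Wide (x , y) → x < y
  wide⇒< = ℕ.<⇒≤

  module _ {xs ys : List (Segment n)} (T : Tidy i m xs) (U : Tidy m j ys) where

    tidy-++ : i ≤ m → m ≤ j → Tidy i j (xs ++ ys)
    tidy-++ i≤m m≤j .within d∈ with ∈-++⁻ xs d∈
    ... | inj₁ d∈xs = let i≤x , y≤m , w = within T d∈xs in i≤x , ℕ.≤-trans y≤m m≤j , w
    ... | inj₂ d∈ys = let m≤x , y≤j , w = within U d∈ys in ℕ.≤-trans i≤m m≤x , y≤j , w
    tidy-++ i≤m m≤j .distinct = Unique.++⁺ (distinct T) (distinct U) λ (d∈xs , d∈ys) →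
      let _ , y≤m , w = within T d∈xs ; m≤x , _ = within U d∈ys in
      ℕ.<⇒≱ (wide⇒< w) (ℕ.≤-trans y≤m m≤x)
    tidy-++ i≤m m≤j .crossfree ab∈ cd∈ a<c c<b b<d with ∈-++⁻ xs ab∈ | ∈-++⁻ xs cd∈
    ... | inj₁ ab∈xs | inj₁ cd∈xs = crossfree T ab∈xs cd∈xs a<c c<b b<d
    ... | inj₂ ab∈ys | inj₂ cd∈ys = crossfree U ab∈ys cd∈ys a<c c<b b<d
    ... | inj₁ ab∈xs | inj₂ cd∈ys =
      ℕ.<⇒≱ c<b (ℕ.≤-trans (proj₁ (proj₂ (within T ab∈xs))) (proj₁ (within U cd∈ys)))
    ... | inj₂ ab∈ys | inj₁ cd∈xs =
      ℕ.<⇒≱ (ℕ.<-trans c<b b<d) (ℕ.≤-trans (proj₁ (proj₂ (within T cd∈xs)))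
        (ℕ.≤-trans (proj₁ (within U ab∈ys)) (ℕ.<⇒≤ a<c)))

    whole∉++ : i < m → m < j → (i , j) ∉ xs ++ ys
    whole∉++ i<m m<j d∈ with ∈-++⁻ xs d∈
    ... | inj₁ d∈xs = ℕ.<⇒≱ m<j (proj₁ (proj₂ (within T d∈xs)))
    ... | inj₂ d∈ys = ℕ.<⇒≱ i<m (proj₁ (within U d∈ys))

  module _ {i j : Fin n} {xs : List (Segment n)} (T : Tidy i j xs) where

    tidy-∷ : Wide (i , j) → (i , j) ∉ xs → Tidy i j ((i , j) ∷ xs)
    tidy-∷ w ij∉ .within (here refl) = ℕ.≤-refl , ℕ.≤-refl , w
    tidy-∷ w ij∉ .within (there d∈)  = within T d∈
    tidy-∷ w ij∉ .distinct = All.tabulate (λ { d∈ refl → ij∉ d∈ }) ∷ distinct T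
    tidy-∷ w ij∉ .crossfree (here refl) (here refl) a<c _ _ = ℕ.<-irrefl refl a<c
    tidy-∷ w ij∉ .crossfree (here refl) (there cd∈) _ _ b<d = ℕ.<⇒≱ b<d (proj₁ (proj₂ (within T cd∈)))
    tidy-∷ w ij∉ .crossfree (there ab∈) (here refl) a<c _ _ = ℕ.<⇒≱ a<c (proj₁ (within T ab∈))
    tidy-∷ w ij∉ .crossfree (there ab∈) (there cd∈) = crossfree T ab∈ cd∈

  tidy-[] : Tidy i j []
  tidy-[] .within ()
  tidy-[] .distinct = []
  tidy-[] .crossfree ()

  tidy-fork : {xs ys : List (Segment n)} → Tidy i m xs → Tidy m j ys → i < m → m < j →
              Tidy i j ((i , j) ∷ xs ++ ys)
  tidy-fork T U i<m m<j =
    tidy-∷ (tidy-++ T U (ℕ.<⇒≤ i<m) (ℕ.<⇒≤ m<j)) (ℕ.≤-<-trans i<m m<j) (whole∉++ T U i<m m<j)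

  tidyˢ : (s : Span t i j) → Tidy i j (chordsˢ s)
  tidyˢ (side _)   = tidy-[]
  tidyˢ (fork l r) = tidy-fork (tidyˢ l) (tidyˢ r) (span-< l) (span-< r)

  tidyᶜ : (ss : Chain ts i j) → Tidy i j (chordsᶜ ss)
  tidyᶜ []       = tidy-[]
  tidyᶜ (s ∷ ss) = tidy-++ (tidyˢ s) (tidyᶜ ss) (ℕ.<⇒≤ (span-< s)) (chain-≤ ss)

  tidyᵃ : (a : Around c i j g h) {xs : List (Segment n)} → Tidy g h ((g , h) ∷ xs) → g < h →
          Tidy i j (chordsᵃ a xs)
  tidyᵃ here        T g<h = T
  tidyᵃ (left a s)  T g<h = tidy-fork (tidyᵃ a T g<h) (tidyˢ s) (around-< a g<h) (span-< s)
  tidyᵃ (right s a) T g<h = tidy-fork (tidyˢ s) (tidyᵃ a T g<h) (span-< s) (around-< a g<h)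

  -- Two trees are the minimum here: with a single one, `(g , h)` would be a side (i , i + 1) or
  -- repeat the base of that tree.
  tidy-gon : {ts : Vec Shape (suc (suc r))} (ss : Chain ts g h) → Tidy g h ((g , h) ∷ chordsᶜ ss)
  tidy-gon (s ∷ ss) = tidy-fork (tidyˢ s) (tidyᶜ ss) (span-< s) (chain-< ss)

  -- The trees along the path lie entirely before `g` or after `h`, and the path segments above
  -- `(g , h)` stick out beyond it at one end at least.
  inner-chord : (a : Around c i j g h) {xs : List (Segment n)} → (x , y) ∈ chordsᵃ a xs →
                g ≤ x → y ≤ h → x < y → (x ≡ g × y ≡ h) ⊎ (x , y) ∈ xs
  inner-chord here        (here refl) _ _ _ = inj₁ (refl , refl)
  inner-chord here        (there d∈)  _ _ _ = inj₂ d∈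
  inner-chord (left a s)  (here refl) g≤x y≤h _ = contradiction
    (ℕ.≤-trans y≤h (proj₂ (around-≤ a))) (ℕ.<⇒≱ (span-< s))
  inner-chord (left a s)  (there d∈)  g≤x y≤h x<y with ∈-++⁻ (chordsᵃ a _) d∈
  ... | inj₁ d∈a = inner-chord a d∈a g≤x y≤h x<y
  ... | inj₂ d∈s = contradiction
    (ℕ.≤-trans y≤h (ℕ.≤-trans (proj₂ (around-≤ a)) (proj₁ (within (tidyˢ s) d∈s)))) (ℕ.<⇒≱ x<y)
  inner-chord (right s a) (here refl) g≤x y≤h _ = contradiction
    (ℕ.≤-trans (proj₁ (around-≤ a)) g≤x) (ℕ.<⇒≱ (span-< s))
  inner-chord (right s a) (there d∈)  g≤x y≤h x<y with ∈-++⁻ (chordsˢ s) d∈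
  ... | inj₁ d∈s = contradiction
    (ℕ.≤-trans (proj₁ (proj₂ (within (tidyˢ s) d∈s))) (ℕ.≤-trans (proj₁ (around-≤ a)) g≤x)) (ℕ.<⇒≱ x<y)
  ... | inj₂ d∈a = inner-chord a d∈a g≤x y≤h x<y

  -- A chord of the chain belongs to one of its trees, which occupies the range between two
  -- successive corners.
  uncut-corner : (ss : Chain ts i j) → (x , y) ∈ chordsᶜ ss → v ∈ corners ss → x < v → v < y → ⊥
  uncut-corner (s ∷ ss) d∈ v∈ x<v v<y with ∈-++⁻ (chordsˢ s) d∈ | v∈
  ... | inj₁ d∈s  | here refl = ℕ.<⇒≱ x<v (proj₁ (within (tidyˢ s) d∈s))
  ... | inj₁ d∈s  | there v∈  =
    ℕ.<⇒≱ v<y (ℕ.≤-trans (proj₁ (proj₂ (within (tidyˢ s) d∈s))) (proj₁ (corners-≤ ss v∈)))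
  ... | inj₂ d∈ss | here refl =
    ℕ.<⇒≱ x<v (ℕ.≤-trans (ℕ.<⇒≤ (span-< s)) (proj₁ (within (tidyᶜ ss) d∈ss)))
  ... | inj₂ d∈ss | there v∈  = uncut-corner ss d∈ss v∈ x<v v<y

  -- The faces of a drawing

  module Drawings {D : List (Segment n)} (L : Laminar D) where

    open Laminar L
    open Uniqueness L
    open Faces L

    apexesˢ : (s : Span t i j) → Drawn D (chordsˢ s) → All (HasApex D) (chordsˢ s)
    apexesˢ (side _)   _        = []
    apexesˢ (fork l r) (_ ∷ dr) =
      let dl , dr = All.++⁻ (chordsˢ l) dr in
      (_ , span-< l , span-< r , span-edge l dl , span-edge r dr) ∷ All.++⁺ (apexesˢ l dl) (apexesˢ r dr)

    apexesᶜ : (ss : Chain ts i j) → Drawn D (chordsᶜ ss) → All (HasApex D) (chordsᶜ ss)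
    apexesᶜ []       _  = []
    apexesᶜ (s ∷ ss) dr =
      let ds , dss = All.++⁻ (chordsˢ s) dr in All.++⁺ (apexesˢ s ds) (apexesᶜ ss dss)

    apexesᵃ : (a : Around c i j g h) {xs : List (Segment n)} → g < h →
              Drawn D (chordsᵃ a xs) → All (HasApex D) xs →
              All (λ d → d ≡ (g , h) ⊎ HasApex D d) (chordsᵃ a xs)
    apexesᵃ here        g<h _        ap = inj₁ refl ∷ All.map inj₂ ap
    apexesᵃ (left a s)  g<h (_ ∷ dr) ap =
      let da , ds = All.++⁻ (chordsᵃ a _) dr in
      inj₂ (_ , around-< a g<h , span-< s , around-edge a da , span-edge s ds) ∷
      All.++⁺ (apexesᵃ a g<h da ap) (All.map inj₂ (apexesˢ s ds))
    apexesᵃ (right s a) g<h (_ ∷ dr) ap =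
      let ds , da = All.++⁻ (chordsˢ s) dr in
      inj₂ (_ , span-< s , around-< a g<h , span-edge s ds , around-edge a da) ∷
      All.++⁺ (All.map inj₂ (apexesˢ s ds)) (apexesᵃ a g<h da ap)

    corner-or-covered : (ss : Chain ts i j) → Drawn D (chordsᶜ ss) → i ≤ v → v ≤ j →
      v ∈ corners ss ⊎ (∃[ p ] ∃[ q ] Edge D p q × i ≤ p × p < v × v < q × q ≤ j)
    corner-or-covered [] _ i≤v v≤i = inj₁ (here (Fin.≤-antisym v≤i i≤v))
    corner-or-covered {v = v} (_∷_ {i = i} {m = m} s ss) dr i≤v v≤j
      with ds , dss ← All.++⁻ (chordsˢ s) dr
      with v Fin.≟ i | ℕ.≤-<-connex (toℕ m) (toℕ v)
    ... | yes v≡i | _        = inj₁ (here v≡i)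
    ... | no  v≢i | inj₂ v<m =
      inj₂ (_ , _ , span-edge s ds , ℕ.≤-refl , ≢∧≤⇒< (v≢i ∘ sym) i≤v , v<m , chain-≤ ss)
    ... | no  _   | inj₁ m≤v with corner-or-covered ss dss m≤v v≤j
    ...   | inj₁ v∈ = inj₁ (there v∈)
    ...   | inj₂ (p , q , pq , m≤p , rest) = inj₂ (p , q , pq , ℕ.≤-trans (ℕ.<⇒≤ (span-< s)) m≤p , rest)

    -- By `inner-chord` and `uncut-corner`, nothing within `(g , h)` but `(g , h)` passes over a
    -- corner. Any other vertex lies under the base of a tree, and this base differs from `(g , h)`
    -- because there are at least two trees: the first base ends before `h`, the others start after
    -- `g`.
    gon≡face : {ts : Vec Shape (suc (suc r))} (a : Around c i j g h) (ss : Chain ts g h) →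
               Drawn D (chordsᵃ a (chordsᶜ ss)) →
               (∀ {x y} → Edge D x y → Wide (x , y) → (x , y) ∈ chordsᵃ a (chordsᶜ ss)) →
               fromList (corners ss) ≡ face D (g , h)
    gon≡face {g = g} {h} a ss@(s ∷ ss′) dr all = Subset.⊆-antisym
      (λ v∈ → let v∈ = ∈-fromList⁻ _ v∈ ; g≤v , v≤h = corners-≤ ss v∈ in
         ∈-comprehension⁺ (visible? D g h) (g≤v , v≤h , unhidden v∈))
      (λ v∈ → let g≤v , v≤h , vis = ∈-comprehension⁻ (visible? D g h) v∈ in
         ∈-fromList⁺ (corner g≤v v≤h vis))
      where
      g<h = chain-< ss
      dss : Drawn D (chordsᶜ ss)
      dss = All.tabulate λ d∈ → All.lookup dr (base⊆ a d∈)

      unhidden : ∀ {v} → v ∈ corners ss →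
                 ∀ x y → Edge D x y → g ≤ x → x < v → v < y → y ≤ h → x ≡ g × y ≡ h
      unhidden v∈ x y xy g≤x x<v v<y y≤h
        with inner-chord a (all xy (ℕ.≤-<-trans x<v v<y)) g≤x y≤h (ℕ.<-trans x<v v<y)
      ... | inj₁ xy≡gh = xy≡gh
      ... | inj₂ xy∈   = ⊥-elim (uncut-corner ss xy∈ v∈ x<v v<y)

      corner : ∀ {v} → g ≤ v → v ≤ h →
               (∀ x y → Edge D x y → g ≤ x → x < v → v < y → y ≤ h → x ≡ g × y ≡ h) → v ∈ corners ss
      corner {v} g≤v v≤h vis
        with ds , dss′ ← All.++⁻ (chordsˢ s) dss
        with v Fin.≟ g | ℕ.≤-<-connex (toℕ _) (toℕ v)
      ... | yes v≡g | _        = here v≡g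
      ... | no  v≢g | inj₂ v<m = contradiction
        (proj₂ (vis _ _ (span-edge s ds) ℕ.≤-refl (≢∧≤⇒< (v≢g ∘ sym) g≤v) v<m (chain-≤ ss′)))
        (Fin.<⇒≢ (chain-< ss′))
      ... | no  _   | inj₁ m≤v with corner-or-covered ss′ dss′ m≤v v≤h
      ...   | inj₁ v∈ = there v∈
      ...   | inj₂ (p , q , pq , m≤p , p<v , v<q , q≤h) =
        let g<p = ℕ.<-≤-trans (span-< s) m≤p in
        contradiction (sym (proj₁ (vis p q pq (ℕ.<⇒≤ g<p) p<v v<q q≤h))) (Fin.<⇒≢ g<p)

-- Counting

leaves : Shape → ℕ
leaves leaf       = 1
leaves (fork s t) = leaves s + leaves t

leavesᶜ : ∀ {r} → Vec Shape r → ℕ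
leavesᶜ []       = 0
leavesᶜ (t ∷ ts) = leaves t + leavesᶜ ts

leavesᵃ : List (Shape ⊎ Shape) → ℕ
leavesᵃ []           = 0
leavesᵃ (inj₁ t ∷ c) = leaves t + leavesᵃ c
leavesᵃ (inj₂ t ∷ c) = leaves t + leavesᵃ c

leaves>0 : ∀ t → 0 ℕ.< leaves t
leaves>0 leaf       = s≤s z≤n
leaves>0 (fork s t) = ℕ.≤-trans (leaves>0 s) (ℕ.m≤m+n _ _)

size≤leavesᶜ : ∀ {r} (ts : Vec Shape r) → r ℕ.≤ leavesᶜ ts
size≤leavesᶜ []       = z≤n
size≤leavesᶜ (t ∷ ts) = ℕ.+-mono-≤ (leaves>0 t) (size≤leavesᶜ ts)

-- The configurations counted by F(r , l), as trees without vertices; they will stand for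
-- dissections with k = r + 1 and n = l + 1.
Blueprint : ℕ → ℕ → Set
Blueprint r l = Σ[ c ∈ List (Shape ⊎ Shape) ] Σ[ ts ∈ Vec Shape r ] leavesᵃ c + leavesᶜ ts ≡ l

blueprint-≡ : ∀ {r l c c′} {ts ts′ : Vec Shape r}
              {e : leavesᵃ c + leavesᶜ ts ≡ l} {e′ : leavesᵃ c′ + leavesᶜ ts′ ≡ l} →
              c ≡ c′ → ts ≡ ts′ → _≡_ {A = Blueprint r l} (c , ts , e) (c′ , ts′ , e′)
blueprint-≡ {e = e} {e′} refl refl rewrite ℕ.≡-irrelevant e e′ = refl

-- The recurrence for F(r , l) with r > 0 as a bijection, according to whether the first tree is a
-- leaf or a fork.
uncons-blueprint : ∀ r l → Blueprint (suc r) (suc l) ↔ (Blueprint r l ⊎ Blueprint (suc (suc r)) (suc l))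
uncons-blueprint r l = mk↔ₛ′ to from to∘from from∘to
  where
  to : Blueprint (suc r) (suc l) → Blueprint r l ⊎ Blueprint (suc (suc r)) (suc l)
  to (c , leaf ∷ ts , e)     = inj₁ (c , ts , ℕ.suc-injective (trans (sym (ℕ.+-suc (leavesᵃ c) _)) e))
  to (c , fork s t ∷ ts , e) = inj₂ (c , s ∷ t ∷ ts ,
    trans (cong (leavesᵃ c +_) (sym (ℕ.+-assoc (leaves s) (leaves t) (leavesᶜ ts)))) e)

  from : Blueprint r l ⊎ Blueprint (suc (suc r)) (suc l) → Blueprint (suc r) (suc l)
  from (inj₁ (c , ts , e))         = c , leaf ∷ ts , trans (ℕ.+-suc (leavesᵃ c) _) (cong suc e)
  from (inj₂ (c , s ∷ t ∷ ts , e)) = c , fork s t ∷ ts ,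
    trans (cong (leavesᵃ c +_) (ℕ.+-assoc (leaves s) (leaves t) (leavesᶜ ts))) e

  to∘from : ∀ b → to (from b) ≡ b
  to∘from (inj₁ _)                = cong inj₁ (blueprint-≡ refl refl)
  to∘from (inj₂ (c , s ∷ t ∷ ts , e)) = cong inj₂ (blueprint-≡ refl refl)

  from∘to : ∀ b → from (to b) ≡ b
  from∘to (c , leaf ∷ ts , e)     = blueprint-≡ refl refl
  from∘to (c , fork s t ∷ ts , e) = blueprint-≡ refl refl

-- The recurrence F(0 , l) = 2 F(1 , l) as a bijection. Since the number of leaves is positive, the
-- path has a first triangle.
unwrap-blueprint : ∀ l → Blueprint 0 (suc l) ↔ (Blueprint 1 (suc l) ⊎ Blueprint 1 (suc l))
unwrap-blueprint l = mk↔ₛ′ to from to∘from from∘to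
  where
  rotate : ∀ p q → q + (p + 0) ≡ p + q + 0
  rotate = solve-∀

  to : Blueprint 0 (suc l) → Blueprint 1 (suc l) ⊎ Blueprint 1 (suc l)
  to (inj₁ t ∷ c , [] , e) = inj₁ (c , t ∷ [] , trans (rotate (leaves t) (leavesᵃ c)) e)
  to (inj₂ t ∷ c , [] , e) = inj₂ (c , t ∷ [] , trans (rotate (leaves t) (leavesᵃ c)) e)

  from : Blueprint 1 (suc l) ⊎ Blueprint 1 (suc l) → Blueprint 0 (suc l)
  from (inj₁ (c , t ∷ [] , e)) = inj₁ t ∷ c , [] , trans (sym (rotate (leaves t) (leavesᵃ c))) e
  from (inj₂ (c , t ∷ [] , e)) = inj₂ t ∷ c , [] , trans (sym (rotate (leaves t) (leavesᵃ c))) e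

  to∘from : ∀ b → to (from b) ≡ b
  to∘from (inj₁ (c , t ∷ [] , e)) = cong inj₁ (blueprint-≡ refl refl)
  to∘from (inj₂ (c , t ∷ [] , e)) = cong inj₂ (blueprint-≡ refl refl)

  from∘to : ∀ b → from (to b) ≡ b
  from∘to (inj₁ t ∷ c , [] , e) = blueprint-≡ refl refl
  from∘to (inj₂ t ∷ c , [] , e) = blueprint-≡ refl refl

↔Fin-⊎ : ∀ {A B C : Set} {p q s} → A ↔ (B ⊎ C) → B ↔ Fin p → C ↔ Fin q → p + q ≡ s → A ↔ Fin s
↔Fin-⊎ split B↔ C↔ refl = ↔-trans split (↔-trans (B↔ ⊎-↔ C↔) (↔-sym Fin.+↔⊎))

odd-C-symmetric : ∀ l → suc (l + l) C l ≡ suc (l + l) C suc l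
odd-C-symmetric l = trans (nCk≡nC[n∸k] (ℕ.m≤n⇒m≤1+n (ℕ.m≤m+n l l)))
  (cong (suc (l + l) C_) (trans (ℕ.+-∸-assoc 1 (ℕ.m≤m+n l l)) (cong suc (ℕ.m+n∸m≡n l l))))

-- Both reductions shorten w by one, which gives Pascal's rule; for r = 0 the two
-- terms of the rule are equal by symmetry.

count-blueprints : ∀ w r l → w + r ≡ 2 * l → Blueprint r l ↔ Fin (w C l)
count-blueprints zero r zero refl = mk↔ₛ′ (λ _ → zero) (λ _ → [] , [] , refl) (λ { zero → refl }) unique
  where
  leafless : ∀ t c → leaves t + leavesᵃ c + 0 ≢ 0
  leafless t c e = ℕ.<⇒≢ (leaves>0 t) (sym (ℕ.m+n≡0⇒m≡0 _ (ℕ.m+n≡0⇒m≡0 _ e)))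

  unique : ∀ b → ([] , [] , refl) ≡ b
  unique ([] , [] , refl)       = refl
  unique (inj₁ t ∷ c , [] , e) = ⊥-elim (leafless t c e)
  unique (inj₂ t ∷ c , [] , e) = ⊥-elim (leafless t c e)
-- Here r = 2(l + 1), but r trees need at least r leaves and there are only l + 1.
count-blueprints zero r (suc l) refl = subst (λ s → Blueprint r (suc l) ↔ Fin s)
  (sym (k>n⇒nCk≡0 (s≤s (z≤n {l}))))
  (mk↔ₛ′ (⊥-elim ∘ none) (λ ()) (λ ()) (⊥-elim ∘ none))
  where
  none : Blueprint r (suc l) → ⊥
  none (c , ts , e) = ℕ.<⇒≱ (ℕ.m<m+n (suc l) {suc l + 0} (s≤s z≤n))
    (ℕ.≤-trans (size≤leavesᶜ ts) (ℕ.≤-trans (ℕ.m≤n+m _ (leavesᵃ c)) (ℕ.≤-reflexive e)))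
count-blueprints (suc w) zero (suc l) w+0≡2l = ↔Fin-⊎ (unwrap-blueprint l) ih ih
  (trans (cong (_+ w C suc l) w-odd) (nCk+nC[k+1]≡[n+1]C[k+1] w l))
  where
  w≡ : w ≡ suc (l + l)
  w≡ = ℕ.suc-injective (trans (sym (ℕ.+-identityʳ (suc w))) (trans w+0≡2l (double l)))
    where
    double : ∀ l → 2 * suc l ≡ suc (suc (l + l))
    double = solve-∀
  w-odd : w C suc l ≡ w C l
  w-odd = subst (λ w → w C suc l ≡ w C l) (sym w≡) (sym (odd-C-symmetric l))
  ih = count-blueprints w 1 (suc l) (trans (ℕ.+-suc w 0) w+0≡2l)
count-blueprints (suc w) (suc r) (suc l) e = ↔Fin-⊎ (uncons-blueprint r l)
  (count-blueprints w r l (ℕ.suc-injective (ℕ.suc-injective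
    (trans (cong suc (sym (ℕ.+-suc w r))) (trans e (double l))))))
  (count-blueprints w (suc (suc r)) (suc l) (trans (ℕ.+-suc w (suc r)) e))
  (nCk+nC[k+1]≡[n+1]C[k+1] w l)
  where
  double : ∀ l → 2 * suc l ≡ suc (suc (2 * l))
  double = solve-∀

-- Placing trees in the n-gon

module _ {n : ℕ} where

  private
    variable
      i j g h : Fin n
      c : List (Shape ⊎ Shape)

  Placed : ∀ {r} → List (Shape ⊎ Shape) → Vec Shape r → Fin n → Fin n → Set
  Placed c ts i j = Σ[ g ∈ Fin n ] Σ[ h ∈ Fin n ] Around c i j g h × Chain ts g h

  length-span : ∀ {t} → Span t i j → toℕ i + leaves t ≡ toℕ j
  length-span {i = i} (side j≡1+i) = trans (ℕ.+-comm (toℕ i) 1) (sym j≡1+i)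
  length-span {i = i} (fork {s = s} {t = t} l r) =
    trans (sym (ℕ.+-assoc (toℕ i) (leaves s) (leaves t)))
      (trans (cong (_+ leaves t) (length-span l)) (length-span r))

  length-chain : ∀ {r} {ts : Vec Shape r} → Chain ts i j → toℕ i + leavesᶜ ts ≡ toℕ j
  length-chain {i = i} [] = ℕ.+-identityʳ (toℕ i)
  length-chain {i = i} {ts = t ∷ ts} (s ∷ ss) =
    trans (sym (ℕ.+-assoc (toℕ i) (leaves t) (leavesᶜ ts)))
      (trans (cong (_+ leavesᶜ ts) (length-span s)) (length-chain ss))

  swap-last : ∀ i t c w → i + (t + c + w) ≡ i + (c + w) + t
  swap-last = solve-∀

  join-first : ∀ i t c w → i + (t + c + w) ≡ i + t + (c + w)
  join-first = solve-∀

  length-placed : ∀ {r} {ts : Vec Shape r} → Placed c ts i j → toℕ i + (leavesᵃ c + leavesᶜ ts) ≡ toℕ j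
  length-placed (g , h , here , ss) = length-chain ss
  length-placed {i = i} {ts = ts} (g , h , left {c = c} {t = t} a s , ss) =
    trans (swap-last (toℕ i) (leaves t) (leavesᵃ c) (leavesᶜ ts))
      (trans (cong (_+ leaves t) (length-placed (g , h , a , ss))) (length-span s))
  length-placed {i = i} {ts = ts} (g , h , right {t = t} {c = c} s a , ss) =
    trans (join-first (toℕ i) (leaves t) (leavesᵃ c) (leavesᶜ ts))
      (trans (cong (_+ (leavesᵃ c + leavesᶜ ts)) (length-span s)) (length-placed (g , h , a , ss)))

  span-irrelevant : ∀ {t} (p q : Span t i j) → p ≡ q
  span-irrelevant (side e)   (side e′)    = cong side (ℕ.≡-irrelevant e e′)
  span-irrelevant (fork l r) (fork l′ r′)
    with refl ← Fin.toℕ-injective (trans (sym (length-span l)) (length-span l′))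
    = cong₂ fork (span-irrelevant l l′) (span-irrelevant r r′)

  chain-irrelevant : ∀ {r} {ts : Vec Shape r} (p q : Chain ts i j) → p ≡ q
  chain-irrelevant []      []      = refl
  chain-irrelevant (s ∷ p) (t ∷ q)
    with refl ← Fin.toℕ-injective (trans (sym (length-span s)) (length-span t))
    = cong₂ _∷_ (span-irrelevant s t) (chain-irrelevant p q)

  -- The numbers of leaves fix all the vertices at which trees meet, `g` and `h` included. This
  -- allows a drawing read off a dissection to be replaced by the one that `place` computes.
  placed-irrelevant : ∀ {r} {ts : Vec Shape r} (p q : Placed c ts i j) → p ≡ q
  placed-irrelevant (_ , _ , here , p) (_ , _ , here , q) =
    cong (λ ss → _ , _ , here , ss) (chain-irrelevant p q)
  placed-irrelevant (g , h , left a s , p) (g′ , h′ , left b t , q)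
    with refl ← Fin.toℕ-injective
           (trans (sym (length-placed (g , h , a , p))) (length-placed (g′ , h′ , b , q)))
    with refl ← span-irrelevant s t
    = cong (λ (g , h , a , p) → g , h , left a s , p) (placed-irrelevant (g , h , a , p) (g′ , h′ , b , q))
  placed-irrelevant (g , h , right s a , p) (g′ , h′ , right t b , q)
    with refl ← Fin.toℕ-injective (trans (sym (length-span s)) (length-span t))
    with refl ← span-irrelevant s t
    = cong (λ (g , h , a , p) → g , h , right s a , p) (placed-irrelevant (g , h , a , p) (g′ , h′ , b , q))

  offset : ∀ (i j : Fin n) p q → toℕ i + p + q ≡ toℕ j → ∃[ m ] toℕ i + p ≡ toℕ {n} m
  offset i j p q e = fromℕ< i+p<n , sym (Fin.toℕ-fromℕ< i+p<n)
    where
    i+p<n : toℕ i + p ℕ.< n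
    i+p<n = ℕ.≤-<-trans (ℕ.≤-trans (ℕ.m≤m+n _ q) (ℕ.≤-reflexive e)) (Fin.toℕ<n j)

  place-span : ∀ t (i j : Fin n) → toℕ i + leaves t ≡ toℕ j → Span t i j
  place-span leaf       i j e = side (trans (sym e) (ℕ.+-comm (toℕ i) 1))
  place-span (fork s t) i j e =
    let e       = trans (ℕ.+-assoc (toℕ i) (leaves s) (leaves t)) e
        m , im = offset i j (leaves s) (leaves t) e
    in fork (place-span s i m im) (place-span t m j (trans (cong (_+ leaves t) (sym im)) e))

  place-chain : ∀ {r} (ts : Vec Shape r) (i j : Fin n) → toℕ i + leavesᶜ ts ≡ toℕ j → Chain ts i j
  place-chain [] i j e with refl ← Fin.toℕ-injective (trans (sym (ℕ.+-identityʳ (toℕ i))) e) = []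
  place-chain (t ∷ ts) i j e =
    let e       = trans (ℕ.+-assoc (toℕ i) (leaves t) (leavesᶜ ts)) e
        m , im = offset i j (leaves t) (leavesᶜ ts) e
    in place-span t i m im ∷ place-chain ts m j (trans (cong (_+ leavesᶜ ts) (sym im)) e)

  place : ∀ {r} c (ts : Vec Shape r) (i j : Fin n) →
          toℕ i + (leavesᵃ c + leavesᶜ ts) ≡ toℕ j → Placed c ts i j
  place [] ts i j e = i , j , here , place-chain ts i j e
  place (inj₁ t ∷ c) ts i j e =
    let e                = trans (sym (swap-last (toℕ i) (leaves t) (leavesᵃ c) (leavesᶜ ts))) e
        m , im          = offset i j (leavesᵃ c + leavesᶜ ts) (leaves t) e
        g , h , a , ss = place c ts i m im
    in g , h , left a (place-span t m j (trans (cong (_+ leaves t) (sym im)) e)) , ss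
  place (inj₂ t ∷ c) ts i j e =
    let e                = trans (sym (join-first (toℕ i) (leaves t) (leavesᵃ c) (leavesᶜ ts))) e
        m , im          = offset i j (leaves t) (leavesᵃ c + leavesᶜ ts) e
        g , h , a , ss = place c ts m j (trans (cong (_+ (leavesᵃ c + leavesᶜ ts)) (sym im)) e)
    in g , h , right (place-span t i m im) a , ss

  -- Numbers of chords

  chord-count-span : ∀ {t} (s : Span t i j) → suc (length (chordsˢ s)) ≡ leaves t
  chord-count-span (side _)   = refl
  chord-count-span (fork l r) = trans
    (cong (λ p → suc (suc p)) (List.length-++ (chordsˢ l)))
    (trans (sym (ℕ.+-suc (suc (length (chordsˢ l))) _)) (cong₂ _+_ (chord-count-span l) (chord-count-span r)))

  chord-count-chain : ∀ {r} {ts : Vec Shape r} (ss : Chain ts i j) → length (chordsᶜ ss) + r ≡ leavesᶜ ts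
  chord-count-chain []                 = refl
  chord-count-chain {r = suc r} (s ∷ ss) = trans
    (cong (_+ suc r) (List.length-++ (chordsˢ s)))
    (trans (shuffle (length (chordsˢ s)) (length (chordsᶜ ss)) r)
      (cong₂ _+_ (chord-count-span s) (chord-count-chain ss)))
    where
    shuffle : ∀ p q r → p + q + suc r ≡ suc p + (q + r)
    shuffle = solve-∀

  -- A path triangle contributes its base and the nodes of its tree, in all as many chords as the
  -- tree has leaves. The remaining `suc` accounts for `(g , h)`.
  chord-count-around : (a : Around c i j g h) (xs : List (Segment n)) →
                       length (chordsᵃ a xs) ≡ leavesᵃ c + suc (length xs)
  chord-count-around here xs = refl
  chord-count-around (left {c = c} {t = t} a s) xs = trans
    (cong suc (List.length-++ (chordsᵃ a xs)))
    (trans (cong₂ (λ p q → suc (p + q)) (chord-count-around a xs) refl)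
    (trans (shuffle (leavesᵃ c) (length xs) (length (chordsˢ s)))
      (cong (λ p → p + leavesᵃ c + suc (length xs)) (chord-count-span s))))
    where
    shuffle : ∀ p q r → suc (p + suc q + r) ≡ suc r + p + suc q
    shuffle = solve-∀
  chord-count-around (right {t = t} {c = c} s a) xs = trans
    (cong suc (List.length-++ (chordsˢ s)))
    (trans (cong (λ p → suc (length (chordsˢ s) + p)) (chord-count-around a xs))
    (trans (shuffle (leavesᵃ c) (length xs) (length (chordsˢ s)))
      (cong (λ p → p + leavesᵃ c + suc (length xs)) (chord-count-span s))))
    where
    shuffle : ∀ p q r → suc (r + (p + suc q)) ≡ suc r + p + suc q
    shuffle = solve-∀

-- Dissections from trees and back

unique-map : ∀ {A B : Set} (f : A → B) {xs} → (∀ {x y} → x ∈ xs → y ∈ xs → f x ≡ f y → x ≡ y) →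
             Unique xs → Unique (map f xs)
unique-map f {[]}     inj _        = []
unique-map f {x ∷ xs} inj (x∉ ∷ u) =
  All.map⁺ (All.tabulate λ y∈ fx≡fy → All.lookup x∉ y∈ (inj (here refl) (there y∈) fx≡fy)) ∷
  unique-map f (λ x∈ y∈ → inj (there x∈) (there y∈)) u

-- The preimage chosen by surjectivity is the inverse map; injectivity makes it respect the equality
-- of the setoid.
bijective⇒cardinality : ∀ {S : Setoid _ _} {N} {A : Set} → A ↔ Fin N → (f : A → Setoid.Carrier S) →
  (∀ x → ∃[ a ] Setoid._≈_ S (f a) x) → (∀ {a b} → Setoid._≈_ S (f a) (f b) → a ≡ b) → HasCardinality S N
bijective⇒cardinality {S} A↔ f surj inj = record
  { to        = λ x → Inverse.to A↔ (proj₁ (surj x))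
  ; from      = λ i → f (Inverse.from A↔ i)
  ; to-cong   = λ {x} {y} x≈y → cong (Inverse.to A↔)
      (inj (S.trans (proj₂ (surj x)) (S.trans x≈y (S.sym (proj₂ (surj y))))))
  ; from-cong = λ { refl → S.refl }
  ; inverse   =
      (λ {i} {x} x≈ → trans (cong (Inverse.to A↔) (inj (S.trans (proj₂ (surj x)) x≈)))
                           (Inverse.strictlyInverseˡ A↔ i)) ,
      (λ {x} {i} i≡ → S.trans
        (S.reflexive (cong f (trans (cong (Inverse.from A↔) i≡) (Inverse.strictlyInverseʳ A↔ _))))
        (proj₂ (surj x))) }
  where module S = Setoid S

edge-mono : ∀ {n} {D D′ : List (Segment n)} {i j} → (∀ {d} → d ∈ D → d ∈ D′) → Edge D i j → Edge D′ i j
edge-mono D⊆ (inj₁ s)  = inj₁ s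
edge-mono D⊆ (inj₂ d∈) = inj₂ (D⊆ d∈)

module _ {p : ℕ} where

  private
    -- `L` is the number of leaves: one for each side of the n-gon except the root (0 , n - 1).
    L N : ℕ
    L = suc (suc p)
    N = suc L

    last : Fin N
    last = fromℕ L

    root : Segment N
    root = zero , last

  root-edge : ∀ (D : List (Segment N)) → Edge D zero last
  root-edge D = inj₁ (inj₂ (refl , cong suc (Fin.toℕ-fromℕ L)))

  root-wide : Wide root
  root-wide = subst (1 ℕ.<_) (sym (Fin.toℕ-fromℕ L)) (s≤s (s≤s z≤n))

  wide-side : ∀ {i j : Fin N} → IsSide (i , j) → Wide (i , j) → (i , j) ≡ root
  wide-side (inj₁ j≡1+i) w = contradiction (sym j≡1+i) (ℕ.<⇒≢ w)
  wide-side (inj₂ (i≡0 , 1+j≡n)) _ = cong₂ _,_ (Fin.toℕ-injective i≡0)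
    (Fin.toℕ-injective (trans (ℕ.suc-injective 1+j≡n) (sym (Fin.toℕ-fromℕ L))))

  wide-edge : ∀ {D : List (Segment N)} {i j} → Edge D i j → Wide (i , j) → (i , j) ∈ root ∷ D
  wide-edge (inj₁ s)  w = here (wide-side s w)
  wide-edge (inj₂ d∈) _ = there d∈

  diagonal-wide : ∀ {d : Segment N} → IsDiagonal d → Wide d
  diagonal-wide (i<j , ¬side) = ℕ.≤∧≢⇒< i<j (λ j≡1+i → ¬side (inj₁ (sym j≡1+i)))

  -- The dissection drawn by a configuration

  module Drawing {r : ℕ} {c : List (Shape ⊎ Shape)} {ts : Vec Shape (suc (suc r))}
    (size : leavesᵃ c + leavesᶜ ts ≡ L)
    {g h : Fin N} (a : Around c zero last g h) (ss : Chain ts g h) where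

    chords diagonals : List (Segment N)
    chords    = chordsᵃ a (chordsᶜ ss)
    diagonals = remove _≟ˢ_ root chords

    gon : Subset N
    gon = fromList (corners ss)

    private
      k : ℕ
      k = suc (suc (suc r))

    g<h : g < h
    g<h = chain-< ss

    tidy : Tidy zero last chords
    tidy = tidyᵃ a (tidy-gon ss) g<h

    open Tidy tidy

    wide : ∀ {d} → d ∈ chords → Wide d
    wide d∈ = proj₂ (proj₂ (within d∈))

    diagonals⊆chords : ∀ {d} → d ∈ diagonals → d ∈ chords
    diagonals⊆chords d∈ = proj₁ (∈-remove⁻ _≟ˢ_ chords d∈)

    drawn : Drawn diagonals chords
    drawn = All.tabulate edge
      where
      edge : ∀ {d} → d ∈ chords → uncurry (Edge diagonals) d
      edge {d} d∈ with root ≟ˢ d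
      ... | yes refl   = root-edge diagonals
      ... | no  root≢d = inj₂ (∈-remove⁺ _≟ˢ_ d∈ root≢d)

    edge-drawn : ∀ {x y} → Edge diagonals x y → Wide (x , y) → (x , y) ∈ chords
    edge-drawn xy w with wide-edge xy w
    ... | here refl = outer∈ a _
    ... | there d∈  = diagonals⊆chords d∈

    -- There are n - k + 1 chords, one above each part.
    chord-count : length chords + suc (suc r) ≡ N
    chord-count = trans (cong (_+ suc (suc r)) (chord-count-around a (chordsᶜ ss)))
      (trans (shuffle (leavesᵃ c) (length (chordsᶜ ss)) (suc (suc r)))
        (cong suc (trans (cong (leavesᵃ c +_) (chord-count-chain ss)) size)))
      where
      shuffle : ∀ x y z → x + suc y + z ≡ suc (x + (y + z))
      shuffle = solve-∀

    -- Serves twice: without the root, the chords are the n - k diagonals; without `(g , h)`, they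
    -- are the n - k segments above the triangles.
    removed-count : ∀ {d} → d ∈ chords → length (remove _≟ˢ_ d chords) ≡ N ∸ k
    removed-count {d} d∈ = trans (sym (ℕ.m+n∸n≡m (length (remove _≟ˢ_ d chords)) k)) (cong (_∸ k)
      (trans (ℕ.+-suc (length (remove _≟ˢ_ d chords)) (suc (suc r)))
        (trans (cong (_+ suc (suc r)) (length-remove _≟ˢ_ distinct d∈)) chord-count)))

    isDissection : IsDissection (N ∸ k) diagonals
    isDissection = record
      { diagonals   = All.tabulate λ d∈ → wide⇒< (wide (diagonals⊆chords d∈)) ,
                        λ side → proj₂ (∈-remove⁻ _≟ˢ_ chords d∈)
                          (sym (wide-side side (wide (diagonals⊆chords d∈))))
      ; unique      = remove-unique _≟ˢ_ distinct
      ; size        = removed-count (outer∈ a _)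
      ; noncrossing = λ { d∈ e∈ (inj₁ (i<k , k<j , j<l)) →
                            crossfree (diagonals⊆chords d∈) (diagonals⊆chords e∈) i<k k<j j<l
                        ; d∈ e∈ (inj₂ (k<i , i<l , l<j)) →
                            crossfree (diagonals⊆chords e∈) (diagonals⊆chords d∈) k<i i<l l<j } }

    lam : Laminar diagonals
    lam = laminar (s≤s (s≤s z≤n)) (IsDissection.diagonals isDissection) (IsDissection.noncrossing isDissection)

    open Drawings lam
    open Faces lam

    gon≡ : gon ≡ face diagonals (g , h)
    gon≡ = gon≡face a ss drawn edge-drawn

    face-part : ∀ {d} → d ∈ chords → IsPart diagonals (face diagonals d)
    face-part d∈ = face-isPart (All.lookup drawn d∈) (wide d∈)

    gon-part : IsPart diagonals gon
    gon-part = subst (IsPart diagonals) (sym gon≡) (face-part (inner∈ a _))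

    gon-size : ∣ gon ∣ ≡ k
    gon-size = trans (∣fromList∣ (corners-unique ss)) (length-corners ss)

    others : List (Segment N)
    others = remove _≟ˢ_ (g , h) chords

    others⊆chords : ∀ {d} → d ∈ others → d ∈ chords
    others⊆chords d∈ = proj₁ (∈-remove⁻ _≟ˢ_ chords d∈)

    apexes : All (λ d → d ≡ (g , h) ⊎ HasApex diagonals d) chords
    apexes = apexesᵃ a g<h drawn (apexesᶜ ss (All.tabulate λ d∈ → All.lookup drawn (base⊆ a d∈)))

    other-triangle : ∀ {d} → d ∈ others → IsTriangle (face diagonals d)
    other-triangle {d} d∈ = triangle (All.lookup apexes (others⊆chords d∈)) (proj₂ (∈-remove⁻ _≟ˢ_ chords d∈))
      where
      triangle : d ≡ (g , h) ⊎ HasApex diagonals d → (g , h) ≢ d → IsTriangle (face diagonals d)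
      triangle (inj₁ d≡gh)    gh≢d = contradiction (sym d≡gh) gh≢d
      triangle (inj₂ (_ , t)) _    = apex-triangle t

    chord-faces : ∀ {d e} → d ∈ chords → e ∈ chords → face diagonals d ≡ face diagonals e → d ≡ e
    chord-faces d∈ e∈ = face-injective (wide⇒< (wide d∈)) (wide⇒< (wide e∈))

    -- A part is the face below the edge joining its extreme vertices, and this edge is a chord
    -- because it is wide. The chord `(g , h)` gives the marked polygon, every other chord one of
    -- the remaining faces.
    parts⇔ : ∀ S → IsPart diagonals S ⇔ S ∈ gon ∷ map (face diagonals) others
    parts⇔ S = mk⇔ to from
      where
      to : IsPart diagonals S → S ∈ gon ∷ map (face diagonals) others
      to part = let x , y , E = part-ends part in to′ part E ((g , h) ≟ˢ (x , y))
        where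
        to′ : ∀ {x y} → IsPart diagonals S → Ends S x y → Dec ((g , h) ≡ (x , y)) →
              S ∈ gon ∷ map (face diagonals) others
        to′ part E (yes refl) = here (trans (part≡face part E) (sym gon≡))
        to′ part E (no  ≢gh)  = there (subst (_∈ map (face diagonals) others) (sym (part≡face part E))
          (∈-map⁺ (face diagonals) (∈-remove⁺ _≟ˢ_ (edge-drawn (ends-edge part E) (ends-wide part E)) ≢gh)))
      from : S ∈ gon ∷ map (face diagonals) others → IsPart diagonals S
      from (here S≡gon) = subst (IsPart diagonals) (sym S≡gon) gon-part
      from (there S∈)   = let d , d∈ , S≡ = ∈-map⁻ (face diagonals) S∈ in
        subst (IsPart diagonals) (sym S≡) (face-part (others⊆chords d∈))

    parts : PartsAreOneGonAndTriangles k diagonals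
    parts = record
      { gon            = gon
      ; triangles      = map (face diagonals) others
      ; gon-size       = gon-size
      ; triangles-size = All.map⁺ (All.tabulate other-triangle)
      ; triangles-num  = trans (List.length-map (face diagonals) others) (removed-count (inner∈ a _))
      ; distinct       = All.map⁺ (All.tabulate λ d∈ gon≡fd → proj₂ (∈-remove⁻ _≟ˢ_ chords d∈)
                           (chord-faces (inner∈ a _) (others⊆chords d∈) (trans (sym gon≡) gon≡fd)))
                         ∷ unique-map (face diagonals)
                             (λ d∈ e∈ → chord-faces (others⊆chords d∈) (others⊆chords e∈))
                             (remove-unique _≟ˢ_ distinct)
      ; parts          = parts⇔ }

  module Realise {r : ℕ} (b : Blueprint (suc (suc r)) L) where

    placed : Placed (proj₁ b) (proj₁ (proj₂ b)) zero last
    placed = place _ _ zero last (trans (proj₂ (proj₂ b)) (sym (Fin.toℕ-fromℕ L)))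

    open Drawing (proj₂ (proj₂ b)) (proj₁ (proj₂ (proj₂ placed))) (proj₂ (proj₂ (proj₂ placed))) public

  -- Configurations correspond to dissections

  module _ {r : ℕ} where

    -- Both drawings are read as drawings in the diagonals of `b`. The common polygon fixes `g` and
    -- `h` as its extreme vertices, after which path and chain are determined separately.
    realise-injective : ∀ (b b′ : Blueprint (suc (suc r)) L) →
      Realise.diagonals b ∼[ set ] Realise.diagonals b′ → Realise.gon b ≡ Realise.gon b′ → b ≡ b′
    realise-injective b@(c , ts , e) b′@(c′ , ts′ , e′) D∼ gon≡ =
      same R.placed R′.placed R.drawn drawn′ gon≡
      where
      module R  = Realise b
      module R′ = Realise b′
      drawn′ : Drawn R.diagonals R′.chords
      drawn′ = All.map (edge-mono (Equivalence.from D∼)) R′.drawn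
      open Uniqueness R.lam
      same : (p : Placed c ts zero last) (q : Placed c′ ts′ zero last) →
        (let (_ , _ , a , ss) = p ; (_ , _ , a′ , ss′) = q) →
        Drawn R.diagonals (chordsᵃ a (chordsᶜ ss)) → Drawn R.diagonals (chordsᵃ a′ (chordsᶜ ss′)) →
        fromList (corners ss) ≡ fromList (corners ss′) → b ≡ b′
      same (g , h , a , ss) (g′ , h′ , a′ , ss′) dr dr′ G≡
        with refl , refl ← ends-unique (gon-ends ss) (subst (λ S → Ends S g′ h′) (sym G≡) (gon-ends ss′))
        = blueprint-≡ (around-unique a a′ (chain-< ss) dr dr′)
            (chain-unique ss ss′
              (All.tabulate λ d∈ → All.lookup dr (base⊆ a d∈))
              (All.tabulate λ d∈ → All.lookup dr′ (base⊆ a′ d∈))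
              (λ v∈ → ∈-fromList⁻ _ (subst (_ Subset.∈_) G≡ (∈-fromList⁺ v∈)))
              (λ v∈ → ∈-fromList⁻ _ (subst (_ Subset.∈_) (sym G≡) (∈-fromList⁺ v∈))))

    realise-surjective : ∀ {D : List (Segment N)} {G} → IsDissection (N ∸ suc (suc (suc r))) D →
      (lam : Laminar D) → IsPart D G → ∣ G ∣ ≡ suc (suc (suc r)) →
      (∀ {g h} → Ends G g h → ∀ {i j} → Edge D i j → Wide (i , j) → ¬ (i ≡ g × j ≡ h) → HasApex D (i , j)) →
      ∃[ b ] (Realise.diagonals {r} b ∼[ set ] D) × (Realise.gon {r} b ≡ G)
    realise-surjective {D} {G} dis lam part ∣G∣ apex with Faces.part-ends lam part
    ... | g , h , ends = build chain drawn (Subset.⊆-antisym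
          (λ v∈ → sound (∈-fromList⁻ _ v∈))
          (λ v∈ → ∈-fromList⁺ (complete v∈ (proj₁ (Ends.bounds ends v∈)))))
      where
      open Parsing lam part ends (apex ends)
      open Parsed parse-chain

      Matches : ∀ {c} {ts : Vec Shape (suc (suc r))} → leavesᵃ c + leavesᶜ ts ≡ L → Placed c ts zero last → Set
      Matches e (_ , _ , a , ss) = (Drawing.diagonals e a ss ∼[ set ] D) × (Drawing.gon e a ss ≡ G)

      build : ∀ {size} {ts : Vec Shape size} (ss : Chain ts g h) →
              Drawn D (chordsᶜ ss) → fromList (corners ss) ≡ G →
              ∃[ b ] (Realise.diagonals {r} b ∼[ set ] D) × (Realise.gon {r} b ≡ G)
      build {ts = ts} ss dss gon≡G
        -- The number of trees found by parsing is one less than the number of vertices of `G`.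
        with refl ← ℕ.suc-injective (trans (sym (length-corners ss))
               (trans (sym (∣fromList∣ (corners-unique ss))) (trans (cong ∣_∣ gon≡G) ∣G∣)))
        with c , a , da ← parse-around (root-edge D) z≤n (Fin.≤fromℕ h) dss
        -- `Realise` draws the trees with `place`; the claim is proved for the parsed drawing and
        -- then transferred.
        = (c , ts , e) , subst (Matches {c} {ts} e)
            (placed-irrelevant (g , h , a , ss) (Realise.placed (c , ts , e))) (D∼ , gon≡G)
        where
        e : leavesᵃ c + leavesᶜ ts ≡ L
        e = trans (length-placed (g , h , a , ss)) (Fin.toℕ-fromℕ L)
        module R = Drawing e a ss
        sub : ∀ {d} → d ∈ R.diagonals → d ∈ D
        sub d∈ with ∈-remove⁻ _≟ˢ_ R.chords d∈
        ... | d∈chords , root≢d with wide-edge (All.lookup da d∈chords) (R.wide d∈chords)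
        ...   | here d≡root = contradiction (sym d≡root) root≢d
        ...   | there d∈D   = d∈D
        -- Both sides have n ∸ k elements, so one inclusion suffices.
        D∼ : R.diagonals ∼[ set ] D
        D∼ = mk⇔ sub (⊆⇒⊇ _≟ˢ_ (IsDissection.unique R.isDissection) sub
          (ℕ.≤-reflexive (trans (IsDissection.size dis) (sym (IsDissection.size R.isDissection)))))

  dissection-laminar : ∀ {m} {D : List (Segment N)} → IsDissection m D → Laminar D
  dissection-laminar dis = laminar (s≤s (s≤s z≤n)) (IsDissection.diagonals dis) (IsDissection.noncrossing dis)

  -- Each inner vertex of the n-gon is an inner vertex of the face below exactly one
  -- edge, and every face has one.  A triangulation has as many faces as there are
  -- inner vertices, so none of its faces has two.

  module Triangulation {D : List (Segment N)} (dis : IsDissection (N ∸ 3) D) where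

    lam = dissection-laminar dis

    open IsDissection dis
    open Laminar lam
    open Faces lam

    Owns : Segment N → Fin N → Set
    Owns (i , j) v = i < v × v < j × Visible D i j v

    -- `interior` supplies one vertex for each edge, and `owner-unique` keeps these vertices apart.
    owners : ∀ {xs : List (Segment N)} → Unique xs → (∀ {i j} → (i , j) ∈ xs → Edge D i j × Wide (i , j)) →
             ∃[ vs ] length vs ≡ length xs × Unique vs × (∀ {v} → v ∈ vs → ∃[ d ] d ∈ xs × Owns d v)
    owners {[]} _ _ = [] , refl , [] , λ ()
    owners {(i , j) ∷ xs} (ij∉ ∷ u) edges
      with vs , len , u′ , own ← owners u (edges ∘ there)
      with ij , wide ← edges (here refl)
      with m , i<m , m<j , vis ← interior wide
      = m ∷ vs , cong suc len , All.tabulate fresh ∷ u′ , own′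
      where
      fresh : ∀ {v} → v ∈ vs → m ≢ v
      fresh v∈ refl with (x , y) , d∈ , x<m , m<y , vis′ ← own v∈
        = All.lookup ij∉ d∈ (uncurry (cong₂ _,_)
            (owner-unique ij (proj₁ (edges (there d∈))) vis vis′ i<m m<j x<m m<y))
      own′ : ∀ {v} → v ∈ m ∷ vs → ∃[ d ] d ∈ (i , j) ∷ xs × Owns d v
      own′ (here refl) = (i , j) , here refl , i<m , m<j , vis
      own′ (there v∈)  = let d , d∈ , o = own v∈ in d , there d∈ , o

    edges : ∀ {i j} → (i , j) ∈ root ∷ D → Edge D i j × Wide (i , j)
    edges (here refl) = root-edge D , root-wide
    edges (there d∈)  = inj₂ d∈ , diagonal-wide (All.lookup diagonals d∈)

    root∷D-unique : Unique (root ∷ D)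
    root∷D-unique = All.tabulate (λ { d∈ refl →
      proj₂ (All.lookup diagonals d∈) (inj₂ (refl , cong suc (Fin.toℕ-fromℕ L))) }) ∷ unique

    unowned : ∀ {i j v vs} → Edge D i j →
              (∀ {x} → x ∈ vs → ∃[ d ] d ∈ remove _≟ˢ_ (i , j) (root ∷ D) × Owns d x) →
              Owns (i , j) v → v ∉ vs
    unowned ij own (i<v , v<j , vis) v∈ =
      let _ , d∈ , c<v , v<d , vis′ = own v∈
          d∈ , ij≢d = ∈-remove⁻ _≟ˢ_ (root ∷ D) d∈
      in ij≢d (uncurry (cong₂ _,_) (owner-unique ij (proj₁ (edges d∈)) vis vis′ i<v v<j c<v v<d))

    -- Otherwise `v`, `w`, one vertex for each of the other n - 3 members of `root ∷ D`, and the
    -- vertices 0 and n - 1 would be n + 1 distinct vertices.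
    sole-owned : ∀ {i j v w} → Edge D i j → Wide (i , j) → Owns (i , j) v → Owns (i , j) w → v < w → ⊥
    sole-owned {i} {j} {v} {w} ij wide v-owned w-owned v<w =
      let vs , len , u , own = owners (remove-unique _≟ˢ_ {x = i , j} root∷D-unique)
                                 (λ d∈ → edges (proj₁ (∈-remove⁻ _≟ˢ_ (root ∷ D) d∈)))
      in overfull vs len u own
      where
      overfull : ∀ vs → length vs ≡ length (remove _≟ˢ_ (i , j) (root ∷ D)) → Unique vs →
                 (∀ {x} → x ∈ vs → ∃[ d ] d ∈ remove _≟ˢ_ (i , j) (root ∷ D) × Owns d x) → ⊥
      overfull vs len u own = ℕ.<⇒≱ (ℕ.≤-reflexive (sym count))
        (ℕ.≤-trans (unique⇒length≤∣p∣ {p = Subset.⊤} distinct λ _ → Subset.∈⊤) (Subset.∣p∣≤n Subset.⊤))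
        where
        inner : ∀ {x d} → Owns d x → zero {n = L} < x × x < last
        inner (c<x , x<d , _) = ℕ.≤-<-trans z≤n c<x , ℕ.<-≤-trans x<d (Fin.≤fromℕ _)

        0<v : zero {n = L} < v
        0<v = proj₁ (inner v-owned)

        w<last : w < last
        w<last = proj₂ (inner w-owned)

        distinct : Unique (zero ∷ v ∷ w ∷ last ∷ vs)
        distinct =
          (Fin.<⇒≢ 0<v ∷ Fin.<⇒≢ (ℕ.<-trans 0<v v<w) ∷ Fin.<⇒≢ (ℕ.<-trans (ℕ.<-trans 0<v v<w) w<last) ∷
            All.tabulate (λ x∈ → Fin.<⇒≢ (proj₁ (inner (proj₂ (proj₂ (own x∈))))))) ∷
          (Fin.<⇒≢ v<w ∷ Fin.<⇒≢ (ℕ.<-trans v<w w<last) ∷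
            All.tabulate (λ { x∈ refl → unowned ij own v-owned x∈ })) ∷
          (Fin.<⇒≢ w<last ∷ All.tabulate (λ { x∈ refl → unowned ij own w-owned x∈ })) ∷
          All.tabulate (λ x∈ → Fin.<⇒≢ (proj₂ (inner (proj₂ (proj₂ (own x∈))))) ∘ sym) ∷ u

        count : length (zero ∷ v ∷ w ∷ last ∷ vs) ≡ suc N
        count = cong (λ l → suc (suc (suc l))) (trans (cong suc len)
          (trans (length-remove _≟ˢ_ root∷D-unique (wide-edge ij wide)) (cong suc size)))

    triangulated : ∀ {i j} → Edge D i j → Wide (i , j) → HasApex D (i , j)
    triangulated {i} {j} ij wide = split
      (triangle-or-more (face-isPart ij wide) (face-ends (ℕ.<⇒≤ (ascending ij))))
      where
      split : (∃[ m ] Apex D i j m) ⊎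
              (∃[ v ] ∃[ w ] v Subset.∈ face D (i , j) × w Subset.∈ face D (i , j) × i < v × v < w × w < j) →
              HasApex D (i , j)
      split (inj₁ apex) = apex
      split (inj₂ (v , w , v∈ , w∈ , i<v , v<w , w<j)) = ⊥-elim (sole-owned ij wide
        (i<v , ℕ.<-trans v<w w<j , ∈-comprehension⁻ (visible? D i j) v∈)
        (ℕ.<-trans i<v v<w , w<j , ∈-comprehension⁻ (visible? D i j) w∈) v<w)

  -- The number of dissections

  blueprints : ∀ r → suc r ℕ.≤ suc L → Blueprint r L ↔ Fin ((2 * N ∸ suc r ∸ 1) C (N ∸ 1))
  -- With k = r + 1 and l = n - 1, the upper entry 2n - k - 1 is 2l - r.
  blueprints r r<N = count-blueprints _ r L (begin
    2 * N ∸ suc r ∸ 1 + r     ≡⟨ cong (_+ r) (ℕ.∸-+-assoc (2 * N) (suc r) 1) ⟩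
    2 * N ∸ (suc r + 1) + r   ≡⟨ cong₂ (λ x y → x ∸ y + r) (double L) (ℕ.+-comm (suc r) 1) ⟩
    2 + 2 * L ∸ (2 + r) + r   ≡⟨ ℕ.m∸n+n≡m (ℕ.≤-trans (ℕ.s≤s⁻¹ r<N) (ℕ.m≤m+n L _)) ⟩
    2 * L                     ∎)
    where
    open ≡-Reasoning
    double : ∀ l → 2 * suc l ≡ 2 + 2 * l
    double = solve-∀

  marked-count : HasCardinality (KInN N 3) ((2 * N ∸ 3 ∸ 1) C (N ∸ 1))
  marked-count = bijective⇒cardinality {KInN N 3} (blueprints 2 (s≤s (s≤s (s≤s z≤n)))) draw surjective
    λ {b} {b′} (D∼ , T≡) → realise-injective b b′ D∼ T≡
    where
    draw : Blueprint 2 L → MarkedTriangulation N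
    draw b = (diagonals , gon) , isDissection , gon-part , gon-size
      where open Realise b
    surjective : ∀ x → ∃[ b ] Setoid._≈_ (KInN N 3) (draw b) x
    surjective ((D , T) , dis , part , tri) =
      realise-surjective dis (dissection-laminar dis) part tri λ _ ij wide _ → Triangulation.triangulated dis ij wide

  draw : ∀ {k} → Blueprint (3 + k) L → UnmarkedDissection N (4 + k)
  draw b = diagonals , isDissection , parts
    where open Realise b

  draw-surjective : ∀ {k} (x : UnmarkedDissection N (4 + k)) → ∃[ b ] proj₁ (draw {k} b) ∼[ set ] proj₁ x
  draw-surjective (D , dis , pts) =
    let b , D∼ , _ = realise-surjective dis lam (Equivalence.from (parts gon) (here refl)) gon-size apex in b , D∼
    where
    open PartsAreOneGonAndTriangles pts
    lam = dissection-laminar dis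
    open Faces lam
    open Laminar lam
    apex : ∀ {g h} → Ends gon g h → ∀ {i j} → Edge D i j → Wide (i , j) → ¬ (i ≡ g × j ≡ h) → HasApex D (i , j)
    apex {g} {h} ends {i} {j} ij wide ij≢gh = split (Equivalence.to (parts (face D (i , j))) part)
      where
      part = face-isPart ij wide
      ends′ = face-ends (ℕ.<⇒≤ (ascending ij))
      -- The face below a wide edge is one of the listed parts. If it is the k-gon, the edge joins
      -- the extreme vertices of the k-gon and so is `(g , h)`; otherwise it is a triangle and has
      -- an apex.
      split : face D (i , j) ∈ gon ∷ triangles → HasApex D (i , j)
      split (here face≡gon) = contradiction (ends-unique (subst (λ S → Ends S i j) face≡gon ends′) ends) ij≢gh
      split (there face∈)   = triangle-apex part ends′ (All.lookup triangles-size face∈)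

  -- The equality compares diagonals only, so the k-gons must be matched first: the k-gon of `b` is
  -- also a part for `b′`, and with at least four vertices it is not one of the triangles.
  draw-injective : ∀ {k} (b b′ : Blueprint (3 + k) L) →
                   proj₁ (draw {k} b) ∼[ set ] proj₁ (draw {k} b′) → b ≡ b′
  draw-injective b b′ D∼ = realise-injective b b′ D∼ (same-gon (Equivalence.to (R′.parts⇔ R.gon) part))
    where
    module R  = Realise b
    module R′ = Realise b′
    part : IsPart R′.diagonals R.gon
    part = record
      { polygon = IsPart.polygon R.gon-part
      ; edges   = λ i j i∈ j∈ i<j → let eq = IsPart.edges R.gon-part i j i∈ j∈ i<j in mk⇔
          (λ con → edge-mono (Equivalence.to D∼) (Equivalence.to eq con))
          (λ ij → Equivalence.from eq (edge-mono (Equivalence.from D∼) ij)) }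
    same-gon : R.gon ∈ R′.gon ∷ map (face R′.diagonals) R′.others → R.gon ≡ R′.gon
    same-gon (here gon≡)  = gon≡
    same-gon (there gon∈) = contradiction
      (trans (sym R.gon-size) (All.lookup (PartsAreOneGonAndTriangles.triangles-size R′.parts) gon∈)) λ ()

  unmarked-count : ∀ k → 4 + k ℕ.≤ N → HasCardinality (KInN N (4 + k)) ((2 * N ∸ (4 + k) ∸ 1) C (N ∸ 1))
  unmarked-count k k≤n = bijective⇒cardinality {KInN N (4 + k)} (blueprints (3 + k) k≤n) (draw {k})
    (draw-surjective {k}) (λ {b} {b′} → draw-injective {k} b b′)

theorem5 : (n k : ℕ) → 3 ℕ.≤ k → k ℕ.≤ n →
           HasCardinality (KInN n k) ((2 * n ∸ k ∸ 1) C (n ∸ 1))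
theorem5 _ (suc (suc (suc zero)))    (s≤s (s≤s (s≤s z≤n))) (s≤s (s≤s (s≤s _)))     = marked-count
theorem5 _ (suc (suc (suc (suc k)))) (s≤s (s≤s (s≤s z≤n))) k≤n@(s≤s (s≤s (s≤s _))) = unmarked-count k k≤n
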